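{- Let $n \geq 1$ be an integer. Then for every prime $p$, $$\sum_{\nu \geq 1} \left\{\frac{n}{p^\nu}\right\} > 1 \quad \iff \quad p \mid \mathrm{denom}\bigl(B_n(x) - B_n\bigr).$$ Moreover, $\mathrm{denom}\bigl(B_n(x) - B_n\bigr)$ is squarefree, so this is a one-to-one correspondence between the primes satisfying the left-hand inequality and the prime divisors of this denominator.
   Context: $\{x\} = x - \lfloor x \rfloor$ denotes the fractional part. The Bernoulli polynomials are defined by $\frac{t e^{xt}}{e^t-1} = \sum_{n\geq 0} B_n(x) \frac{t^n}{n!}$, so $B_n(x) = \sum_{k=0}^n \binom{n}{k} B_k x^{n-k}$, where $B_k = B_k(0)$ is the $k$th Bernoulli number. For a polynomial $f \in \mathbb{Q}[x]$, $\mathrm{denom}(f)$ is the least positive integer $d$ such that $d f \in \mathbb{Z}[x]$. -}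

module Defs where

open import Data.Nat as ℕ using (ℕ; zero; suc; _^_)
open import Data.Nat.Combinatorics using (_C_)
open import Data.Nat.Divisibility using (_∣_)
open import Data.Integer as ℤ using (ℤ)
open import Data.Rational as ℚ using (ℚ; _/_; floor; _+_; _*_; _-_; -_; 0ℚ; 1ℚ; _<_)
open import Data.List using (List; []; _∷_; _++_; [_]; length; zipWith; upTo; foldr; lookup)
open import Data.Maybe using (Maybe; just; nothing)
open import Data.Product using (Σ; _×_; ∃)
open import Relation.Binary.PropositionalEquality using (_≡_)
open import Relation.Nullary using (yes; no)

ℕ→ℚ : ℕ → ℚ
ℕ→ℚ n = ℤ.+ n / 1

frac : ℚ → ℚ
frac x = x - (floor x / 1)

sumℚ : List ℚ → ℚ
sumℚ = foldr _+_ 0ℚ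

at : List ℚ → ℕ → ℚ
at [] _ = 0ℚ
at (x ∷ xs) zero = x
at (x ∷ xs) (suc k) = at xs k

-- Bernoulli numbers B_k = B_k(0) (so B_1 = -1/2), via the standard recurrence
-- obtained from t/(e^t-1) = Σ B_k t^k/k! :
--   B_0 = 1,  B_m = -(1/(m+1)) Σ_{k<m} C(m+1,k) B_k   (m ≥ 1).
-- bernUpTo m = [B_0, …, B_m]
nextBern : ℕ → List ℚ → ℚ
nextBern m bs =
  - ((ℤ.+ 1 / suc m) * sumℚ (Data.List.map (λ k → ℕ→ℚ (suc m C k) * at bs k) (upTo m)))

bernUpTo : ℕ → List ℚ
bernUpTo zero = 1ℚ ∷ []
bernUpTo (suc m) = bernUpTo m ++ (nextBern (suc m) (bernUpTo m) ∷ [])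

B : ℕ → ℚ
B k = at (bernUpTo k) k

-- Polynomials over ℚ as coefficient functions (coefficient of x^i); all
-- polynomials used here have finite support.
Poly : Set
Poly = ℕ → ℚ

-- Bernoulli polynomial B_n(x) = Σ_{k=0}^n C(n,k) B_k x^{n-k};
-- coefficient of x^i is C(n, n-i) B_{n-i} for i ≤ n, and 0 for i > n.
bernPoly : ℕ → Poly
bernPoly n i with i ℕ.≤? n
... | yes _ = ℕ→ℚ (n C (n ℕ.∸ i)) * B (n ℕ.∸ i)
... | no _ = 0ℚ

subConst : Poly → ℚ → Poly
subConst f c zero = f zero - c
subConst f c (suc i) = f (suc i)

IsInt : ℚ → Set
IsInt q = Σ ℤ λ z → q ≡ z / 1

Clears : ℕ → Poly → Set
Clears d f = (i : ℕ) → IsInt (ℕ→ℚ d * f i)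

IsDenom : Poly → ℕ → Set
IsDenom f d = (0 ℕ.< d) × Clears d f × ((e : ℕ) → 0 ℕ.< e → Clears e f → d ℕ.≤ e)

SquareFree : ℕ → Set
SquareFree d = (m : ℕ) → m ℕ.* m ∣ d → m ≡ 1

fracSum : ℕ → ℕ → ℕ → ℚ
fracSum n p zero = 0ℚ
fracSum n p (suc N) with p ^ suc N ℕ.≟ 0
... | yes _ = fracSum n p N
... | no ne = fracSum n p N + frac (_/_ (ℤ.+ n) (p ^ suc N) {{ℕ.≢-nonZero ne}})

-- Σ_{ν ≥ 1} {n/p^ν} > 1.  The terms are nonnegative, so the series' value
-- exceeds 1 iff some partial sum exceeds 1.
FracSeriesGt1 : ℕ → ℕ → Set
FracSeriesGt1 n p = ∃ λ N → 1ℚ < fracSum n p N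

{-# OPTIONS --safe #-}

-- By the von Staudt–Clausen theorem, for 0 < k < n the number C(n,k) B_k has a pole at p, and then a
-- simple one, exactly when p − 1 divides k and p does not divide C(n,k) (for p = 2 and odd k > 1 the
-- pole disappears).  By Lucas, p ∤ C(n,k) means that the base-p digits of k are dominated by those of
-- n, and digit sums are congruent to their numbers modulo p − 1; so such a k exists if and only if the
-- digit sum s of n is at least p, by taking k of digit sum p − 1.  Finally Σ {n/p^ν} = s/(p − 1).
--
-- Von Staudt–Clausen itself is read off from Σ_{i<p} i^m = Σ_j C(m,j) B_{m−j} p^{j+1}/(j+1), where the
-- terms with j ≥ 1 are small and the left-hand side is −1 or 0 modulo p.
module Submission where

open import Defs
open import Data.Empty using (⊥; ⊥-elim)
open import Data.Integer as ℤ using (ℤ)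
import Data.Integer.DivMod as ℤ-DivMod
import Data.Integer.Properties as ℤₚ
open import Data.List using ([]; _∷_; _++_; length; map; applyUpTo)
import Data.List.Properties as Listₚ
open import Data.List.Relation.Unary.All using (_∷_)
open import Data.Nat as ℕ using (ℕ; zero; suc; z≤n; s≤s; _≤_; _∸_; _^_)
open import Data.Nat.Combinatorics using (_C_; nCn≡1; nC1≡n; nCk+nC[k+1]≡[n+1]C[k+1]; k>n⇒nCk≡0)
open import Data.Nat.Coprimality using (Coprime; coprime-Bézout)
open import Data.Nat.Divisibility
open import Data.Nat.DivMod using (_%_; %-distribˡ-+; m%n<n; m≡m%n+[m/n]*n; m/n<m; [m+kn]%n≡m%n; m<n⇒m%n≡m;
  m*n/m*o≡n/o; +-distrib-/-∣ʳ; m<n⇒m/n≡0; m*n/n≡m; m/n*n≡m; /-congˡ; /-congʳ)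
open import Data.Nat.GCD using (gcd; gcd[m,n]∣m; gcd[m,n]∣n; gcd[m,n]≢0; module Bézout)
open import Data.Nat.Induction using (<-rec)
open import Data.Nat.Primality using (Prime; euclidsLemma; prime⇒irreducible; prime⇒nonTrivial; prime⇒nonZero)
open import Data.Nat.Primality.Factorisation using (factorise)
import Data.Nat.Properties as ℕₚ
open import Data.Nat.Solver using () renaming (module +-*-Solver to ℕ-Solver)
open import Data.Product using (Σ; ∃; _×_; _,_; proj₁; proj₂)
open import Data.Sum using (_⊎_; inj₁; inj₂)
open import Function using (_∘_; id)
open import Function.Bundles using (_⇔_; mk⇔)
open import Relation.Binary.PropositionalEquality
open import Relation.Nullary using (¬_; yes; no)
open import Relation.Nullary.Decidable using (decidable-stable)

-- Binomial coefficients modulo a prime and digit sums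

-- The delicate prime is 2. There p - 1 = 1 divides every k, and the term j = 1 of the power sum
-- formula is not small in general. Integrality at 2 therefore rests on even binomial coefficients
-- together with the integrality of 2B_k. For the converse, the k of digit sum p - 1 = 1 is a power
-- of two, hence even or equal to 1, and in both cases the term j = 1 is small after all.
--
-- The denominator is treated one prime at a time. If d = p d′ clears f and d′f is p-integral, then
-- d′ already clears f, against the minimality of d. This gives one implication of the equivalence
-- and, because pB_k is p-integral for every k, squarefreeness as well.
--
-- The formula for the power sums is the identity Σ_{i<N} e^{it} = (e^{Nt} - 1)/t · t/(e^t - 1)
-- between exponential generating functions.

nCk-absorb : ∀ n k → suc k ℕ.* (suc n C suc k) ≡ suc n ℕ.* (n C k)
nCk-absorb zero zero = refl
nCk-absorb zero (suc k) = trans (cong (suc (suc k) ℕ.*_) (k>n⇒nCk≡0 (s≤s (s≤s (z≤n {k})))))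
  (trans (ℕₚ.*-zeroʳ (suc (suc k))) (sym (cong (1 ℕ.*_) (k>n⇒nCk≡0 (s≤s (z≤n {k}))))))
nCk-absorb (suc n) zero = trans (ℕₚ.*-identityˡ _)
    (trans (nC1≡n (suc (suc n))) (sym (ℕₚ.*-identityʳ (suc (suc n)))))
nCk-absorb (suc n) (suc k) = begin
  suc (suc k) ℕ.* (suc (suc n) C suc (suc k))
    ≡⟨ cong (suc (suc k) ℕ.*_) (nCk+nC[k+1]≡[n+1]C[k+1] (suc n) (suc k)) ⟨
  suc (suc k) ℕ.* (x ℕ.+ y)
    ≡⟨ ℕ-Solver.solve 3 (λ k x y → (con′ 2 ⊕ k) ⊗ (x ⊕ y) ⊜ x ⊕ (con′ 1 ⊕ k) ⊗ x ⊕ (con′ 2 ⊕ k) ⊗ y) refl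
        k x y ⟩
  x ℕ.+ suc k ℕ.* x ℕ.+ suc (suc k) ℕ.* y
    ≡⟨ cong₂ (λ u v → x ℕ.+ u ℕ.+ v) (nCk-absorb n k) (nCk-absorb n (suc k)) ⟩
  x ℕ.+ suc n ℕ.* (n C k) ℕ.+ suc n ℕ.* (n C suc k)
    ≡⟨ ℕ-Solver.solve 4 (λ x n u v → x ⊕ (con′ 1 ⊕ n) ⊗ u ⊕ (con′ 1 ⊕ n) ⊗ v ⊜ x ⊕ (con′ 1 ⊕ n) ⊗ (u ⊕ v))
        refl x n (n C k) (n C suc k) ⟩
  x ℕ.+ suc n ℕ.* (n C k ℕ.+ n C suc k) ≡⟨ cong (λ u → x ℕ.+ suc n ℕ.* u) (nCk+nC[k+1]≡[n+1]C[k+1] n k) ⟩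
  suc (suc n) ℕ.* x ∎
  where
  open ≡-Reasoning
  open ℕ-Solver using () renaming (_:+_ to _⊕_; _:*_ to _⊗_; _:=_ to _⊜_; con to con′)
  x = suc n C suc k
  y = suc n C suc (suc k)

module Digits {p : ℕ} (prime-p : Prime p) where
  open import Data.Nat using (_+_; _*_)

  instance
    p≢0 : ℕ.NonZero p
    p≢0 = prime⇒nonZero prime-p

  r : ℕ
  r = ℕ.pred p

  1+r≡p : suc r ≡ p
  1+r≡p = ℕₚ.suc-pred p

  1<p : 1 ℕ.< p
  1<p = ℕ.nonTrivial⇒n>1 p {{prime⇒nonTrivial prime-p}}

  0<r : 0 ℕ.< r
  0<r = ℕₚ.≤-pred (subst (1 ℕ.<_) (sym 1+r≡p) 1<p)

  -- By absorption p divides (k + 1) C(p, k + 1), and p cannot divide k + 1 < p. The prime appears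
  -- as `suc q` because absorption speaks of successors.
  p∣pCk : ∀ {q} → suc q ≡ p → ∀ {k} → k ℕ.< q → p ∣ suc q C suc k
  p∣pCk {q} 1+q≡p {k} k<q = case (euclidsLemma (suc k) (suc q C suc k) prime-p
      (subst (p ∣_) (sym (nCk-absorb q k)) (∣m⇒∣m*n (q C k) (∣-reflexive (sym 1+q≡p)))))
    where
    case : p ∣ suc k ⊎ p ∣ suc q C suc k → p ∣ suc q C suc k
    case (inj₁ h) = ⊥-elim (>⇒∤ (subst (suc k ℕ.<_) 1+q≡p (s≤s k<q)) h)
    case (inj₂ h) = h

  infix 4 _≈_
  _≈_ : ℕ → ℕ → Set
  a ≈ b = a % p ≡ b % p

  ≈-+ : ∀ {a b c d} → a ≈ b → c ≈ d → a + c ≈ b + d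
  ≈-+ {a} {b} {c} {d} h k = trans (%-distribˡ-+ a c p)
      (trans (cong₂ (λ x y → (x + y) % p) h k) (sym (%-distribˡ-+ b d p)))

  ≈-∣ : ∀ {a b} → a ≈ b → p ∣ b → p ∣ a
  ≈-∣ {a} {b} h p∣b = m%n≡0⇒n∣m a p (trans h (n∣m⇒m%n≡0 b p p∣b))

  -- This and `C-+p-high` compare coefficients in (1 + x)^{n+p} ≡ (1 + x)^n (1 + x^p) modulo p,
  -- below and from x^p on.
  C-+p-low : ∀ n k → k ℕ.< p → (n + p) C k ≈ n C k
  C-+p-low n zero _ = refl
  C-+p-low zero (suc k) k<p = trans (n∣m⇒m%n≡0 (p C suc k) p p∣)
      (sym (trans (cong (_% p) (k>n⇒nCk≡0 (s≤s (z≤n {k})))) (n∣m⇒m%n≡0 0 p (p ∣0))))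
    where
    p∣ : p ∣ p C suc k
    p∣ = subst (λ m → p ∣ m C suc k) 1+r≡p (p∣pCk 1+r≡p (ℕₚ.≤-pred (subst (suc k ℕ.<_) (sym 1+r≡p) k<p)))
  C-+p-low (suc n) (suc k) k<p = begin
    ((suc n + p) C suc k) % p ≡⟨ cong (_% p) (nCk+nC[k+1]≡[n+1]C[k+1] (n + p) k) ⟨
    ((n + p) C k + (n + p) C suc k) % p
      ≡⟨ ≈-+ {(n + p) C k} {n C k} (C-+p-low n k (ℕₚ.<-trans (ℕₚ.n<1+n k) k<p)) (C-+p-low n (suc k) k<p) ⟩
    (n C k + n C suc k) % p ≡⟨ cong (_% p) (nCk+nC[k+1]≡[n+1]C[k+1] n k) ⟩
    (suc n C suc k) % p ∎
    where open ≡-Reasoning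

  C-+p-high : ∀ n k → (n + p) C (k + p) ≈ n C (k + p) + n C k
  C-+p-high zero zero = cong (_% p) (trans (nCn≡1 p) (cong (_+ 1) (sym (k>n⇒nCk≡0 (ℕ.>-nonZero⁻¹ p)))))
  C-+p-high zero (suc k) = cong (_% p) (trans (k>n⇒nCk≡0 (ℕₚ.m<n+m p (s≤s (z≤n {k}))))
    (sym (cong₂ _+_ (k>n⇒nCk≡0 (s≤s (z≤n {k + p}))) (k>n⇒nCk≡0 (s≤s (z≤n {k}))))))
  -- Pascal's rule reaches column p - 1 here, outside the form k + p; `C-+p-low` supplies it.
  C-+p-high (suc n) zero = subst (λ q → (suc n + p) C q ≈ suc n C q + 1) 1+r≡p (begin
    ((suc n + p) C suc r) % p ≡⟨ cong (_% p) (nCk+nC[k+1]≡[n+1]C[k+1] (n + p) r) ⟨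
    ((n + p) C r + (n + p) C suc r) % p
      ≡⟨ ≈-+ {(n + p) C r} {n C r} (C-+p-low n r (subst (r ℕ.<_) 1+r≡p (ℕₚ.n<1+n r)))
        (subst (λ q → (n + p) C q ≈ n C q + 1) (sym 1+r≡p) (C-+p-high n zero)) ⟩
    (n C r + (n C suc r + 1)) % p
      ≡⟨ cong (_% p) (trans (sym (ℕₚ.+-assoc (n C r) (n C suc r) 1))
          (cong (_+ 1) (nCk+nC[k+1]≡[n+1]C[k+1] n r))) ⟩
    (suc n C suc r + 1) % p ∎)
    where open ≡-Reasoning
  C-+p-high (suc n) (suc k) = begin
    ((suc n + p) C (suc k + p)) % p ≡⟨ cong (_% p) (nCk+nC[k+1]≡[n+1]C[k+1] (n + p) (k + p)) ⟨
    ((n + p) C (k + p) + (n + p) C (suc k + p)) % p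
      ≡⟨ ≈-+ {(n + p) C (k + p)} {n C (k + p) + n C k} (C-+p-high n k) (C-+p-high n (suc k)) ⟩
    ((n C (k + p) + n C k) + (n C (suc k + p) + n C suc k)) % p
      ≡⟨ cong (_% p) (ℕ-Solver.solve 4 (λ a b c d → (a ⊕ b) ⊕ (c ⊕ d) ⊜ (a ⊕ c) ⊕ (b ⊕ d)) refl (n C (k + p))
          (n C k) (n C (suc k + p)) (n C suc k)) ⟩
    ((n C (k + p) + n C (suc k + p)) + (n C k + n C suc k)) % p
      ≡⟨ cong (_% p) (cong₂ _+_ (nCk+nC[k+1]≡[n+1]C[k+1] n (k + p)) (nCk+nC[k+1]≡[n+1]C[k+1] n k)) ⟩
    (suc n C (suc k + p) + suc n C suc k) % p ∎
    where
    open ≡-Reasoning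
    open ℕ-Solver using () renaming (_:+_ to _⊕_; _:=_ to _⊜_)

  shift : ∀ d x → d + (p + x) ≡ d + x + p
  shift d x = trans (cong (d +_) (ℕₚ.+-comm p x)) (sym (ℕₚ.+-assoc d x p))

  -- Adding p to the upper argument acts on the pair (q, k) as Pascal's rule, so an induction on q
  -- rebuilds C(q, k) while C(d, l) stays a constant factor.
  lucas : ∀ q k {d l} → d ℕ.< p → l ℕ.< p → (d + q * p) C (l + k * p) ≈ (d C l) * (q C k)
  lucas zero zero {d} {l} d<p l<p = cong (_% p) (trans (cong₂ _C_ (ℕₚ.+-identityʳ d) (ℕₚ.+-identityʳ l))
      (sym (ℕₚ.*-identityʳ (d C l))))
  lucas zero (suc k) {d} {l} d<p l<p = cong (_% p)
      (trans (k>n⇒nCk≡0 lt)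
          (sym (trans (cong ((d C l) *_) (k>n⇒nCk≡0 (s≤s (z≤n {k})))) (ℕₚ.*-zeroʳ (d C l)))))
    where
    lt : d + 0 ℕ.< l + (p + k * p)
    lt = subst (ℕ._< l + (p + k * p)) (sym (ℕₚ.+-identityʳ d))
      (ℕₚ.≤-trans d<p (ℕₚ.≤-trans (ℕₚ.m≤m+n p (k * p)) (ℕₚ.m≤n+m (p + k * p) l)))
  lucas (suc q) zero {d} {l} d<p l<p = begin
    ((d + (p + q * p)) C (l + 0)) % p ≡⟨ cong₂ (λ x y → (x C y) % p) (shift d (q * p)) (ℕₚ.+-identityʳ l) ⟩
    ((d + q * p + p) C l) % p ≡⟨ C-+p-low (d + q * p) l l<p ⟩
    ((d + q * p) C l) % p ≡⟨ cong (λ y → ((d + q * p) C y) % p) (ℕₚ.+-identityʳ l) ⟨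
    ((d + q * p) C (l + 0)) % p ≡⟨ lucas q zero d<p l<p ⟩
    ((d C l) * (q C 0)) % p ∎
    where
    open ≡-Reasoning
  lucas (suc q) (suc k) {d} {l} d<p l<p = begin
    ((d + (p + q * p)) C (l + (p + k * p))) % p
      ≡⟨ cong₂ (λ x y → (x C y) % p) (shift d (q * p)) (shift l (k * p)) ⟩
    ((d + q * p + p) C (l + k * p + p)) % p ≡⟨ C-+p-high (d + q * p) (l + k * p) ⟩
    ((d + q * p) C (l + k * p + p) + (d + q * p) C (l + k * p)) % p
      ≡⟨ cong (λ y → ((d + q * p) C y + (d + q * p) C (l + k * p)) % p) (shift l (k * p)) ⟨
    ((d + q * p) C (l + suc k * p) + (d + q * p) C (l + k * p)) % p
      ≡⟨ ≈-+ {(d + q * p) C (l + suc k * p)} {(d C l) * (q C suc k)} (lucas q (suc k) d<p l<p)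
          (lucas q k d<p l<p) ⟩
    ((d C l) * (q C suc k) + (d C l) * (q C k)) % p
      ≡⟨ cong (_% p) (ℕₚ.*-distribˡ-+ (d C l) (q C suc k) (q C k)) ⟨
    ((d C l) * (q C suc k + q C k)) % p
      ≡⟨ cong (λ x → ((d C l) * x) % p) (trans (ℕₚ.+-comm (q C suc k) (q C k)) (nCk+nC[k+1]≡[n+1]C[k+1] q k)) ⟩
    ((d C l) * (suc q C suc k)) % p ∎
    where
    open ≡-Reasoning

  -- DigitSum n s: s is the sum of the base-p digits of n; leading zeros are allowed.
  data DigitSum : ℕ → ℕ → Set where
    [] : DigitSum 0 0
    digit : ∀ d {q s} → d ℕ.< p → DigitSum q s → DigitSum (d + q * p) (d + s)

  digitSum : ∀ n → ∃ (DigitSum n)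
  digitSum = <-rec _ step
    where
    step : ∀ n → (∀ {m} → m ℕ.< n → ∃ (DigitSum m)) → ∃ (DigitSum n)
    step zero _ = 0 , []
    step n@(suc _) rec with rec (m/n<m n p 1<p)
    ... | s , ds = n % p + s , subst (λ m → DigitSum m (n % p + s)) (sym (m≡m%n+[m/n]*n n p))
        (digit (n % p) (m%n<n n p) ds)

  d+qp≡0⇒q≡0 : ∀ d q → d + q * p ≡ 0 → q ≡ 0
  d+qp≡0⇒q≡0 d q e with ℕₚ.m*n≡0⇒m≡0∨n≡0 q (ℕₚ.m+n≡0⇒n≡0 d e)
  ... | inj₁ h = h
  ... | inj₂ h = ⊥-elim (ℕ.≢-nonZero⁻¹ p h)

  digitSum-zero : ∀ {n s} → DigitSum n s → n ≡ 0 → s ≡ 0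
  digitSum-zero [] _ = refl
  digitSum-zero (digit d {q} _ ds) e =
    cong₂ _+_ (ℕₚ.m+n≡0⇒m≡0 d e) (digitSum-zero ds (d+qp≡0⇒q≡0 d q e))

  digitSum-zero⁻¹ : ∀ {n s} → DigitSum n s → s ≡ 0 → n ≡ 0
  digitSum-zero⁻¹ [] _ = refl
  digitSum-zero⁻¹ (digit d _ ds) e = cong₂ (λ x y → x + y * p) (ℕₚ.m+n≡0⇒m≡0 d e)
      (digitSum-zero⁻¹ ds (ℕₚ.m+n≡0⇒n≡0 d e))

  -- Such an n is a power of p. Only the alternative that `Regular` asks for at p = 2 is kept.
  digitSum-one : ∀ {n s} → DigitSum n s → s ≡ 1 → p ∣ n ⊎ n ≡ 1
  digitSum-one (digit zero {q} _ _) _ = inj₁ (n∣m*n q)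
  digitSum-one (digit (suc zero) _ ds) e = inj₂ (cong (λ y → 1 + y * p)
      (digitSum-zero⁻¹ ds (ℕₚ.suc-injective e)))

  -- Derivations for one number may differ in leading zeros, but the digits agree as residues modulo
  -- p. This serves to exclude k = n when the digit sums differ.
  digitSum-unique : ∀ {n n′ s s′} → DigitSum n s → DigitSum n′ s′ → n ≡ n′ → s ≡ s′
  digitSum-unique [] ds′ e = sym (digitSum-zero ds′ (sym e))
  digitSum-unique ds [] e = digitSum-zero ds e
  digitSum-unique (digit d {q} d<p ds) (digit d′ {q′} d′<p ds′) e = cong₂ _+_ d≡d′
      (digitSum-unique ds ds′ (ℕₚ.*-cancelʳ-≡ q q′ p
          (ℕₚ.+-cancelˡ-≡ d (q * p) (q′ * p) (trans e (cong (_+ q′ * p) (sym d≡d′))))))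
    where
    d≡d′ : d ≡ d′
    d≡d′ = begin
      d ≡⟨ m<n⇒m%n≡m d<p ⟨
      d % p ≡⟨ [m+kn]%n≡m%n d q p ⟨
      (d + q * p) % p ≡⟨ cong (_% p) e ⟩
      (d′ + q′ * p) % p ≡⟨ [m+kn]%n≡m%n d′ q′ p ⟩
      d′ % p ≡⟨ m<n⇒m%n≡m d′<p ⟩
      d′ ∎
      where open ≡-Reasoning

  -- Since p = r + 1, a digit d in place i is worth d p^i, which exceeds d by a multiple of r; so
  -- the congruence has a natural quotient.
  digitSum-mod : ∀ {n s} → DigitSum n s → ∃ λ w → n ≡ w * r + s
  digitSum-mod [] = 0 , refl
  digitSum-mod (digit d {q} {s} _ ds) with digitSum-mod ds
  ... | w , refl = (w * r + s) + w , (begin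
    d + (w * r + s) * p ≡⟨ cong (λ x → d + (w * r + s) * x) 1+r≡p ⟨
    d + (w * r + s) * suc r
      ≡⟨ ℕ-Solver.solve 4 (λ d w r s → d ⊕ (w ⊗ r ⊕ s) ⊗ (con 1 ⊕ r) ⊜ ((w ⊗ r ⊕ s) ⊕ w) ⊗ r ⊕ (d ⊕ s)) refl
          d w r s ⟩
    ((w * r + s) + w) * r + (d + s) ∎)
    where
    open ≡-Reasoning
    open ℕ-Solver using (con) renaming (_:+_ to _⊕_; _:*_ to _⊗_; _:=_ to _⊜_)

  ∤-C-small : ∀ d l → l ℕ.≤ d → d ℕ.< p → ¬ p ∣ d C l
  ∤-C-small d zero _ _ = >⇒∤ 1<p
  ∤-C-small (suc d) (suc l) (s≤s l≤d) d<p h = case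
      (euclidsLemma (suc d) (d C l) prime-p (subst (p ∣_) (nCk-absorb d l) (∣n⇒∣m*n (suc l) h)))
    where
    case : p ∣ suc d ⊎ p ∣ d C l → ⊥
    case (inj₁ h) = >⇒∤ d<p h
    case (inj₂ h) = ∤-C-small d l l≤d (ℕₚ.<-trans (ℕₚ.n<1+n d) d<p) h

  ∤-C-≤ : ∀ {n k} → ¬ p ∣ n C k → k ℕ.≤ n
  ∤-C-≤ {n} {k} h = ℕₚ.≮⇒≥ λ n<k → h (subst (p ∣_) (sym (k>n⇒nCk≡0 n<k)) (p ∣0))

  -- By Lucas each digit of k is at most that of n. For k < n some digit is strictly smaller: either
  -- the lowest one, or one of the quotients by p.
  ∤-C-digitSum : ∀ {n s} → DigitSum n s → ∀ k → ¬ p ∣ n C k →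
    ∃ λ t → DigitSum k t × t ℕ.≤ s × (k ℕ.< n → t ℕ.< s)
  ∤-C-digitSum [] zero _ = 0 , [] , z≤n , λ ()
  ∤-C-digitSum [] (suc k) h = ⊥-elim (ℕₚ.<⇒≱ (s≤s (z≤n {k})) (∤-C-≤ h))
  ∤-C-digitSum (digit d {q} {s} d<p ds) k h = subst Goal (sym k≡) goal
    where
    l = k % p
    k′ = k ℕ./ p
    Goal : ℕ → Set
    Goal k = ∃ λ t → DigitSum k t × t ℕ.≤ d + s × (k ℕ.< d + q * p → t ℕ.< d + s)
    k≡ : k ≡ l + k′ * p
    k≡ = m≡m%n+[m/n]*n k p
    h′ : ¬ p ∣ (d C l) * (q C k′)
    h′ p∣ = h (subst (λ j → p ∣ (d + q * p) C j) (sym k≡)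
        (≈-∣ {(d + q * p) C (l + k′ * p)} (lucas q k′ d<p (m%n<n k p)) p∣))
    l≤d : l ℕ.≤ d
    l≤d = ∤-C-≤ (h′ ∘ ∣m⇒∣m*n (q C k′))
    goal : Goal (l + k′ * p)
    goal with ∤-C-digitSum ds k′ (h′ ∘ ∣n⇒∣m*n (d C l))
    ... | t , dt , t≤s , strict = l + t , digit l (m%n<n k p) dt , ℕₚ.+-mono-≤ l≤d t≤s , strict′
      where
      strict′ : l + k′ * p ℕ.< d + q * p → l + t ℕ.< d + s
      strict′ lt with ℕₚ.m≤n⇒m<n∨m≡n l≤d
      ... | inj₁ l<d = ℕₚ.+-mono-<-≤ l<d t≤s
      ... | inj₂ l≡d = ℕₚ.+-mono-≤-< l≤d
          (strict (ℕₚ.*-cancelʳ-< p k′ q (ℕₚ.+-cancelˡ-< d (k′ * p) (q * p)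
              (subst (λ x → x + k′ * p ℕ.< d + q * p) l≡d lt))))

  -- Greedy choice from the lowest digit: copy the digits of n while the budget t exceeds them, then
  -- spend the rest in one digit and put zeros above. The result is dominated by n digit by digit.
  digitSum-realise : ∀ {n s} → DigitSum n s → ∀ t → t ℕ.≤ s → ∃ λ k → DigitSum k t × ¬ p ∣ n C k
  digitSum-realise [] .0 z≤n = 0 , [] , >⇒∤ 1<p
  digitSum-realise (digit d {q} {s} d<p ds) t t≤d+s with t ℕ.≤? d
  ... | yes t≤d = t + 0 * p , subst (DigitSum (t + 0 * p)) (ℕₚ.+-identityʳ t) (digit t t<p []) ,
      λ p∣ → ∤-C-small d t t≤d d<p (subst (p ∣_) (ℕₚ.*-identityʳ (d C t))
          (≈-∣ {(d C t) * 1} (sym (lucas q 0 d<p t<p)) p∣))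
    where
    t<p : t ℕ.< p
    t<p = ℕₚ.≤-<-trans t≤d d<p
  ... | no t≰d with digitSum-realise ds (t ∸ d) (subst (t ∸ d ℕ.≤_) (ℕₚ.m+n∸m≡n d s) (ℕₚ.∸-monoˡ-≤ d t≤d+s))
  ...   | k , dk , h = d + k * p , subst (DigitSum (d + k * p)) (ℕₚ.m+[n∸m]≡n (ℕₚ.≰⇒≥ t≰d)) (digit d d<p dk) ,
      λ p∣ → h (subst (p ∣_) (trans (cong (_* (q C k)) (nCn≡1 d)) (ℕₚ.*-identityˡ (q C k)))
          (≈-∣ {(d C d) * (q C k)} (sym (lucas q k d<p d<p)) p∣))

  -- Otherwise k has a digit sum t with 0 < t < s ≤ p - 1, although t ≡ k ≡ 0 modulo p - 1.
  C-divisible : ∀ {n s} → DigitSum n s → s ℕ.< p → ∀ k → 0 ℕ.< k → k ℕ.< n → r ∣ k → p ∣ n C k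
  C-divisible {n} {s} ds s<p k 0<k k<n r∣k with p ∣? n C k
  ... | yes h = h
  ... | no h with ∤-C-digitSum ds k h
  ...   | t , dt , _ , strict = ⊥-elim (ℕₚ.<⇒≱ (strict k<n) (ℕₚ.≤-trans s≤r r≤t))
    where
    s≤r : s ℕ.≤ r
    s≤r = ℕₚ.≤-pred (subst (s ℕ.<_) (sym 1+r≡p) s<p)
    w = proj₁ (digitSum-mod dt)
    r∣t : r ∣ t
    r∣t = ∣m+n∣m⇒∣n (subst (r ∣_) (proj₂ (digitSum-mod dt)) r∣k) (n∣m*n w)
    r≤t : r ℕ.≤ t
    r≤t = ∣⇒≤ {{ℕ.≢-nonZero λ t≡0 → ℕₚ.<⇒≢ 0<k (sym (digitSum-zero⁻¹ dt t≡0))}} r∣t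

  -- The last component is the condition `Regular k` under which the congruence for pB_k is proved
  -- later; for p = 2 it holds because k has digit sum r = 1.
  C-nondivisible : ∀ {n s} → DigitSum n s → p ℕ.≤ s →
    ∃ λ k → 0 ℕ.< k × k ℕ.< n × r ∣ k × ¬ p ∣ n C k × (3 ℕ.≤ p ⊎ p ∣ k ⊎ k ≡ 1)
  C-nondivisible {n} {s} ds p≤s = k , 0<k , k<n , r∣k , h , regular
    where
    r<s : r ℕ.< s
    r<s = subst (ℕ._≤ s) (sym 1+r≡p) p≤s
    realised = digitSum-realise ds r (ℕₚ.<⇒≤ r<s)
    k = proj₁ realised
    dk = proj₁ (proj₂ realised)
    h = proj₂ (proj₂ realised)
    0<k : 0 ℕ.< k
    0<k = ℕₚ.n≢0⇒n>0 λ k≡0 → ℕₚ.<⇒≢ 0<r (sym (digitSum-zero dk k≡0))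
    k<n : k ℕ.< n
    k<n = ℕₚ.≤∧≢⇒< (∤-C-≤ h) λ k≡n → ℕₚ.<⇒≢ r<s (digitSum-unique dk ds k≡n)
    r∣k : r ∣ k
    r∣k = subst (r ∣_) (sym (proj₂ (digitSum-mod dk))) (∣m∣n⇒∣m+n (n∣m*n (proj₁ (digitSum-mod dk))) ∣-refl)
    regular : 3 ℕ.≤ p ⊎ p ∣ k ⊎ k ≡ 1
    regular with 3 ℕ.≤? p
    ... | yes 3≤p = inj₁ 3≤p
    ... | no 3≰p = inj₂ (digitSum-one dk (ℕₚ.≤-antisym
        (ℕₚ.≤-pred (ℕₚ.≤-pred (subst (λ x → suc x ℕ.≤ 3) (sym 1+r≡p) (ℕₚ.≰⇒> 3≰p)))) 0<r))

open import Data.Rational as ℚ using (ℚ; _/_; _+_; _*_; _-_; -_; 0ℚ; 1ℚ; floor; fromℚᵘ; mkℚ+)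
import Data.Rational.Properties as ℚₚ
open import Data.Rational.Solver using (module +-*-Solver)
open import Data.Rational.Unnormalised as ℚᵘ using (mkℚᵘ; *≡*)
import Data.Rational.Unnormalised.Properties as ℚᵘₚ
open import Algebra.Properties.Group ℚₚ.+-0-group using () renaming (∙-cancelˡ to +-cancelˡ)
open +-*-Solver using (solve; _:=_; _:+_; _:*_; :-_; _:-_; con)

-- Exponential generating functions and Faulhaber's formula

-- A fraction `z / suc k` is by definition `fromℚᵘ (mkℚᵘ z k)`, so the homomorphism laws move
-- computations with normalised fractions to unnormalised ones.
fromℚᵘ-homo-+ : ∀ x y → fromℚᵘ (x ℚᵘ.+ y) ≡ fromℚᵘ x + fromℚᵘ y
fromℚᵘ-homo-+ x y = ℚₚ.toℚᵘ-injective (ℚᵘₚ.≃-trans (ℚₚ.toℚᵘ-fromℚᵘ (x ℚᵘ.+ y)) (ℚᵘₚ.≃-sym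
  (ℚᵘₚ.≃-trans (ℚₚ.toℚᵘ-homo-+ (fromℚᵘ x) (fromℚᵘ y)) (ℚᵘₚ.+-cong (ℚₚ.toℚᵘ-fromℚᵘ x) (ℚₚ.toℚᵘ-fromℚᵘ y)))))

fromℚᵘ-homo-* : ∀ x y → fromℚᵘ (x ℚᵘ.* y) ≡ fromℚᵘ x * fromℚᵘ y
fromℚᵘ-homo-* x y = ℚₚ.toℚᵘ-injective (ℚᵘₚ.≃-trans (ℚₚ.toℚᵘ-fromℚᵘ (x ℚᵘ.* y)) (ℚᵘₚ.≃-sym
  (ℚᵘₚ.≃-trans (ℚₚ.toℚᵘ-homo-* (fromℚᵘ x) (fromℚᵘ y)) (ℚᵘₚ.*-cong (ℚₚ.toℚᵘ-fromℚᵘ x) (ℚₚ.toℚᵘ-fromℚᵘ y)))))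

ι : ℤ → ℚ
ι z = z / 1

ι-+ : ∀ a b → ι (a ℤ.+ b) ≡ ι a + ι b
ι-+ a b = trans (cong ι (cong₂ ℤ._+_ (sym (ℤₚ.*-identityʳ a)) (sym (ℤₚ.*-identityʳ b))))
    (fromℚᵘ-homo-+ (mkℚᵘ a 0) (mkℚᵘ b 0))

ι-* : ∀ a b → ι (a ℤ.* b) ≡ ι a * ι b
ι-* a b = fromℚᵘ-homo-* (mkℚᵘ a 0) (mkℚᵘ b 0)

ι-injective : ∀ {a b} → ι a ≡ ι b → a ≡ b
ι-injective {a} {b} e with ℚₚ.fromℚᵘ-injective {mkℚᵘ a 0} {mkℚᵘ b 0} e
... | *≡* h = trans (sym (ℤₚ.*-identityʳ a)) (trans h (ℤₚ.*-identityʳ b))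

isInt-+ : ∀ {x y} → IsInt x → IsInt y → IsInt (x + y)
isInt-+ (a , refl) (b , refl) = a ℤ.+ b , sym (ι-+ a b)

isInt-* : ∀ {x y} → IsInt x → IsInt y → IsInt (x * y)
isInt-* (a , refl) (b , refl) = a ℤ.* b , sym (ι-* a b)

isInt-ℕ : ∀ n → IsInt (ℕ→ℚ n)
isInt-ℕ n = ℤ.+ n , refl

isInt-neg : ∀ {x} → IsInt x → IsInt (- x)
isInt-neg {x} h = subst IsInt (solve 1 (λ x → con (ι (ℤ.- (ℤ.+ 1))) :* x := :- x) refl x)
    (isInt-* (ℤ.- (ℤ.+ 1) , refl) h)

ℕ→ℚ-+ : ∀ a b → ℕ→ℚ (a ℕ.+ b) ≡ ℕ→ℚ a + ℕ→ℚ b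
ℕ→ℚ-+ a b = ι-+ (ℤ.+ a) (ℤ.+ b)

ℕ→ℚ-* : ∀ a b → ℕ→ℚ (a ℕ.* b) ≡ ℕ→ℚ a * ℕ→ℚ b
ℕ→ℚ-* a b = trans (cong ι (ℤₚ.pos-* a b)) (ι-* (ℤ.+ a) (ℤ.+ b))

/-* : ∀ z k .{{_ : ℕ.NonZero k}} → (z / k) * ℕ→ℚ k ≡ ι z
/-* z k@(suc k-1) = trans (sym (fromℚᵘ-homo-* (mkℚᵘ z k-1) (mkℚᵘ (ℤ.+ k) 0)))
  (ℚₚ.fromℚᵘ-cong {mkℚᵘ z k-1 ℚᵘ.* mkℚᵘ (ℤ.+ k) 0} {mkℚᵘ z 0}
      (*≡* (trans (ℤₚ.*-identityʳ _) (cong (z ℤ.*_) (cong (ℤ.+_) (sym (ℕₚ.*-identityʳ k)))))))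

1/suc : ℕ → ℚ
1/suc n = ℤ.+ 1 / suc n

1/suc-inverseˡ : ∀ n → 1/suc n * ℕ→ℚ (suc n) ≡ 1ℚ
1/suc-inverseˡ n = /-* (ℤ.+ 1) (suc n)

*-cancelˡ-ℕ : ∀ k .{{_ : ℕ.NonZero k}} {x y} → ℕ→ℚ k * x ≡ ℕ→ℚ k * y → x ≡ y
*-cancelˡ-ℕ (suc n) {x} {y} e = trans (sym (lem x)) (trans (cong (1/suc n *_) e) (lem y))
  where
  lem : ∀ x → 1/suc n * (ℕ→ℚ (suc n) * x) ≡ x
  lem x = trans (sym (ℚₚ.*-assoc (1/suc n) (ℕ→ℚ (suc n)) x))
      (trans (cong (_* x) (1/suc-inverseˡ n)) (ℚₚ.*-identityˡ x))

+-interchange : ∀ a b c d → (a + b) + (c + d) ≡ (a + c) + (b + d)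
+-interchange = solve 4 (λ a b c d → (a :+ b) :+ (c :+ d) := (a :+ c) :+ (b :+ d)) refl

∑ : ℕ → (ℕ → ℚ) → ℚ
∑ zero f = 0ℚ
∑ (suc n) f = f 0 + ∑ n (f ∘ suc)

∑-cong : ∀ n {f g} → (∀ k → k ℕ.< n → f k ≡ g k) → ∑ n f ≡ ∑ n g
∑-cong zero h = refl
∑-cong (suc n) h = cong₂ _+_ (h 0 (s≤s z≤n)) (∑-cong n (λ k k<n → h (suc k) (s≤s k<n)))

∑-+ : ∀ n f g → ∑ n f + ∑ n g ≡ ∑ n (λ k → f k + g k)
∑-+ zero f g = refl
∑-+ (suc n) f g = trans (+-interchange (f 0) _ (g 0) _) (cong (f 0 + g 0 +_) (∑-+ n (f ∘ suc) (g ∘ suc)))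

∑-last : ∀ n f → ∑ (suc n) f ≡ ∑ n f + f n
∑-last zero f = ℚₚ.+-comm (f 0) 0ℚ
∑-last (suc n) f = trans (cong (f 0 +_) (∑-last n (f ∘ suc))) (sym (ℚₚ.+-assoc (f 0) _ _))

infixl 7 _⋆_

-- The product of exponential generating functions, by the Leibniz rule:
-- shifting a sequence differentiates its generating function.
_⋆_ : (ℕ → ℚ) → (ℕ → ℚ) → ℕ → ℚ
(a ⋆ b) zero = a 0 * b 0
(a ⋆ b) (suc n) = (a ∘ suc ⋆ b) n + (a ⋆ b ∘ suc) n

⋆-cong : ∀ {a a′ b b′} → a ≗ a′ → b ≗ b′ → a ⋆ b ≗ a′ ⋆ b′
⋆-cong h k zero = cong₂ _*_ (h 0) (k 0)
⋆-cong h k (suc n) = cong₂ _+_ (⋆-cong (h ∘ suc) k n) (⋆-cong h (k ∘ suc) n)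

⋆-comm : ∀ a b → a ⋆ b ≗ b ⋆ a
⋆-comm a b zero = ℚₚ.*-comm (a 0) (b 0)
⋆-comm a b (suc n) = trans (ℚₚ.+-comm ((a ∘ suc ⋆ b) n) ((a ⋆ b ∘ suc) n))
    (cong₂ _+_ (⋆-comm a (b ∘ suc) n) (⋆-comm (a ∘ suc) b n))

⋆-distribʳ : ∀ c a b → (λ k → a k + b k) ⋆ c ≗ (λ n → (a ⋆ c) n + (b ⋆ c) n)
⋆-distribʳ c a b zero = ℚₚ.*-distribʳ-+ (c 0) (a 0) (b 0)
⋆-distribʳ c a b (suc n) = trans (cong₂ _+_ (⋆-distribʳ c (a ∘ suc) (b ∘ suc) n) (⋆-distribʳ (c ∘ suc) a b n))
  (+-interchange ((a ∘ suc ⋆ c) n) ((b ∘ suc ⋆ c) n) ((a ⋆ c ∘ suc) n) ((b ⋆ c ∘ suc) n))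

⋆-distribˡ : ∀ c a b → c ⋆ (λ k → a k + b k) ≗ (λ n → (c ⋆ a) n + (c ⋆ b) n)
⋆-distribˡ c a b n = trans (⋆-comm c _ n) (trans (⋆-distribʳ c a b n)
    (cong₂ _+_ (⋆-comm a c n) (⋆-comm b c n)))

⋆-assoc : ∀ a b c → a ⋆ b ⋆ c ≗ a ⋆ (b ⋆ c)
⋆-assoc a b c zero = ℚₚ.*-assoc (a 0) (b 0) (c 0)
⋆-assoc a b c (suc n) = begin
  ((λ k → (a ∘ suc ⋆ b) k + (a ⋆ b ∘ suc) k) ⋆ c) n + (a ⋆ b ⋆ c ∘ suc) n
    ≡⟨ cong (_+ (a ⋆ b ⋆ c ∘ suc) n) (⋆-distribʳ c (a ∘ suc ⋆ b) (a ⋆ b ∘ suc) n) ⟩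
  (a ∘ suc ⋆ b ⋆ c) n + (a ⋆ b ∘ suc ⋆ c) n + (a ⋆ b ⋆ c ∘ suc) n
    ≡⟨ cong₂ _+_ (cong₂ _+_ (⋆-assoc (a ∘ suc) b c n) (⋆-assoc a (b ∘ suc) c n)) (⋆-assoc a b (c ∘ suc) n) ⟩
  (a ∘ suc ⋆ (b ⋆ c)) n + (a ⋆ (b ∘ suc ⋆ c)) n + (a ⋆ (b ⋆ c ∘ suc)) n
    ≡⟨ ℚₚ.+-assoc ((a ∘ suc ⋆ (b ⋆ c)) n) _ _ ⟩
  (a ∘ suc ⋆ (b ⋆ c)) n + ((a ⋆ (b ∘ suc ⋆ c)) n + (a ⋆ (b ⋆ c ∘ suc)) n)
    ≡⟨ cong ((a ∘ suc ⋆ (b ⋆ c)) n +_) (⋆-distribˡ a (b ∘ suc ⋆ c) (b ⋆ c ∘ suc) n) ⟨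
  (a ∘ suc ⋆ (b ⋆ c)) n + (a ⋆ (b ⋆ c) ∘ suc) n ∎
  where open ≡-Reasoning

-- The Leibniz form makes the ring laws short inductions; the binomial form exposes the coefficients
-- to be estimated. Pascal's rule matches them.
⋆-binomial : ∀ a b n → (a ⋆ b) n ≡ ∑ (suc n) (λ k → ℕ→ℚ (n C k) * (a k * b (n ∸ k)))
⋆-binomial a b zero = sym (trans (ℚₚ.+-identityʳ _) (ℚₚ.*-identityˡ _))
⋆-binomial a b (suc n) = begin
  (a ∘ suc ⋆ b) n + (a ⋆ b ∘ suc) n
    ≡⟨ cong₂ _+_ (⋆-binomial (a ∘ suc) b n) (⋆-binomial a (b ∘ suc) n) ⟩
  ∑ (suc n) lower + ∑ (suc n) (λ k → ℕ→ℚ (n C k) * (a k * b (suc (n ∸ k))))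
    ≡⟨ cong (∑ (suc n) lower +_) shifted ⟩
  ∑ (suc n) lower + (upper 0 + ∑ (suc n) (upper ∘ suc))
    ≡⟨ solve 3 (λ x y z → x :+ (y :+ z) := y :+ (x :+ z)) refl (∑ (suc n) lower) (upper 0) _ ⟩
  upper 0 + (∑ (suc n) lower + ∑ (suc n) (upper ∘ suc))
    ≡⟨ cong (upper 0 +_) (∑-+ (suc n) lower (upper ∘ suc)) ⟩
  upper 0 + ∑ (suc n) (λ k → lower k + upper (suc k))
    ≡⟨ cong (upper 0 +_) (∑-cong (suc n) λ k _ → pascal k) ⟩
  upper 0 + ∑ (suc n) (λ k → ℕ→ℚ (suc n C suc k) * (a (suc k) * b (n ∸ k))) ∎
  where
  open ≡-Reasoning
  lower upper : ℕ → ℚ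
  lower k = ℕ→ℚ (n C k) * (a (suc k) * b (n ∸ k))
  upper k = ℕ→ℚ (n C k) * (a k * b (suc n ∸ k))
  -- The sum is padded by the term k = n + 1, zero because C(n, n + 1) = 0, so that its first term
  -- can be split off and the others aligned with `lower`.
  shifted : ∑ (suc n) (λ k → ℕ→ℚ (n C k) * (a k * b (suc (n ∸ k)))) ≡ ∑ (suc (suc n)) upper
  shifted = begin
    _
      ≡⟨ ∑-cong (suc n) (λ k k<1+n → cong (λ i → ℕ→ℚ (n C k) * (a k * b i))
          (sym (ℕₚ.+-∸-assoc 1 (ℕₚ.≤-pred k<1+n)))) ⟩
    ∑ (suc n) upper ≡⟨ ℚₚ.+-identityʳ _ ⟨
    ∑ (suc n) upper + 0ℚ
      ≡⟨ cong (∑ (suc n) upper +_)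
          (sym (trans (cong (λ i → ℕ→ℚ i * (a (suc n) * b (n ∸ n))) (k>n⇒nCk≡0 (ℕₚ.n<1+n n)))
              (ℚₚ.*-zeroˡ (a (suc n) * b (n ∸ n))))) ⟩
    ∑ (suc n) upper + upper (suc n) ≡⟨ ∑-last (suc n) upper ⟨
    ∑ (suc (suc n)) upper ∎
  pascal : ∀ k → lower k + upper (suc k) ≡ ℕ→ℚ (suc n C suc k) * (a (suc k) * b (n ∸ k))
  pascal k = trans (sym (ℚₚ.*-distribʳ-+ (a (suc k) * b (n ∸ k)) (ℕ→ℚ (n C k)) (ℕ→ℚ (n C suc k))))
    (cong (_* (a (suc k) * b (n ∸ k))) (trans (sym (ℕ→ℚ-+ (n C k) (n C suc k)))
        (cong ℕ→ℚ (nCk+nC[k+1]≡[n+1]C[k+1] n k))))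

-- The generating function e^{at}. As 0 ^ 0 is 1, `exp 0` is the unit for `_⋆_`.
exp : ℕ → ℕ → ℚ
exp a k = ℕ→ℚ (a ^ k)

-- Differentiation multiplies e^{at}e^{bt} by a + b, as it does e^{(a+b)t}, and the constant terms
-- agree.
exp-⋆ : ∀ a b → exp a ⋆ exp b ≗ exp (a ℕ.+ b)
exp-⋆ a b zero = refl
exp-⋆ a b (suc n) = begin
  (exp a ∘ suc ⋆ exp b) n + (exp a ⋆ exp b ∘ suc) n
    ≡⟨ cong₂ _+_ (scaleˡ a (exp a) (exp b) n) (trans (⋆-comm (exp a) _ n) (scaleˡ b (exp b) (exp a) n)) ⟩
  ℕ→ℚ a * (exp a ⋆ exp b) n + ℕ→ℚ b * (exp b ⋆ exp a) n
    ≡⟨ cong (λ x → ℕ→ℚ a * (exp a ⋆ exp b) n + ℕ→ℚ b * x) (⋆-comm (exp b) (exp a) n) ⟩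
  ℕ→ℚ a * (exp a ⋆ exp b) n + ℕ→ℚ b * (exp a ⋆ exp b) n
    ≡⟨ ℚₚ.*-distribʳ-+ _ (ℕ→ℚ a) (ℕ→ℚ b) ⟨
  (ℕ→ℚ a + ℕ→ℚ b) * (exp a ⋆ exp b) n
    ≡⟨ cong₂ _*_ (sym (ℕ→ℚ-+ a b)) (exp-⋆ a b n) ⟩
  ℕ→ℚ (a ℕ.+ b) * exp (a ℕ.+ b) n
    ≡⟨ ℕ→ℚ-* (a ℕ.+ b) ((a ℕ.+ b) ^ n) ⟨
  exp (a ℕ.+ b) (suc n) ∎
  where
  open ≡-Reasoning
  scale : ∀ c u v → (λ k → c * u k) ⋆ v ≗ (λ n → c * (u ⋆ v) n)
  scale c u v zero = ℚₚ.*-assoc c (u 0) (v 0)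
  scale c u v (suc n) = trans (cong₂ _+_ (scale c (u ∘ suc) v n) (scale c u (v ∘ suc) n))
      (sym (ℚₚ.*-distribˡ-+ c _ _))
  scaleˡ : ∀ a u v → (λ k → ℕ→ℚ (a ℕ.* a ^ k)) ⋆ v ≗ (λ n → ℕ→ℚ a * (exp a ⋆ v) n)
  scaleˡ a u v n = trans (⋆-cong (λ k → ℕ→ℚ-* a (a ^ k)) (λ _ → refl) n) (scale (ℕ→ℚ a) (exp a) v n)

zero-⋆ : ∀ u n → ((λ _ → 0ℚ) ⋆ u) n ≡ 0ℚ
zero-⋆ u zero = ℚₚ.*-zeroˡ (u 0)
zero-⋆ u (suc n) = cong₂ _+_ (zero-⋆ u n) (zero-⋆ (u ∘ suc) n)

exp0-⋆ : ∀ u → exp 0 ⋆ u ≗ u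
exp0-⋆ u zero = ℚₚ.*-identityˡ (u 0)
exp0-⋆ u (suc n) = trans (cong₂ _+_ (zero-⋆ u n) (exp0-⋆ (u ∘ suc) n)) (ℚₚ.+-identityˡ _)

-- The generating functions t and e^t − 1.
X E : ℕ → ℚ
X zero = 0ℚ
X (suc n) = exp 0 n
E zero = 0ℚ
E (suc n) = 1ℚ

X-⋆ : ∀ u n → (X ⋆ u) (suc n) ≡ ℕ→ℚ (suc n) * u n
X-⋆ u zero = trans (cong₂ _+_ (ℚₚ.*-identityˡ (u 0)) (ℚₚ.*-zeroˡ (u 1)))
    (trans (ℚₚ.+-identityʳ (u 0)) (sym (ℚₚ.*-identityˡ (u 0))))
X-⋆ u (suc n) = begin
  (exp 0 ⋆ u) (suc n) + (X ⋆ u ∘ suc) (suc n) ≡⟨ cong₂ _+_ (exp0-⋆ u (suc n)) (X-⋆ (u ∘ suc) n) ⟩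
  u (suc n) + ℕ→ℚ (suc n) * u (suc n)
    ≡⟨ solve 2 (λ x y → x :+ y :* x := (con 1ℚ :+ y) :* x) refl (u (suc n)) (ℕ→ℚ (suc n)) ⟩
  (1ℚ + ℕ→ℚ (suc n)) * u (suc n) ≡⟨ cong (_* u (suc n)) (ℕ→ℚ-+ 1 (suc n)) ⟨
  ℕ→ℚ (suc (suc n)) * u (suc n) ∎
  where open ≡-Reasoning

X-⋆-zero : ∀ u → (X ⋆ u) 0 ≡ 0ℚ
X-⋆-zero u = ℚₚ.*-zeroˡ (u 0)

-- Stands in for division by t: multiplying by t moves u_n to place n + 1 with the nonzero factor n
-- + 1.
X-⋆-cancel : ∀ u v → X ⋆ u ≗ X ⋆ v → u ≗ v
X-⋆-cancel u v h n = *-cancelˡ-ℕ (suc n) (trans (sym (X-⋆ u n)) (trans (h (suc n)) (X-⋆ v n)))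

powerSum : ℕ → ℕ → ℚ
powerSum N k = ∑ N (λ i → exp i k)

exp-suc : ∀ N k → exp N k + (exp N ⋆ E) k ≡ exp (suc N) k
exp-suc N k = begin
  exp N k + (exp N ⋆ E) k
    ≡⟨ cong (_+ (exp N ⋆ E) k) (trans (sym (exp0-⋆ (exp N) k)) (⋆-comm (exp 0) (exp N) k)) ⟩
  (exp N ⋆ exp 0) k + (exp N ⋆ E) k ≡⟨ ⋆-distribˡ (exp N) (exp 0) E k ⟨
  (exp N ⋆ (λ i → exp 0 i + E i)) k ≡⟨ ⋆-cong (λ _ → refl) exp1 k ⟩
  (exp N ⋆ exp 1) k ≡⟨ exp-⋆ N 1 k ⟩
  exp (N ℕ.+ 1) k ≡⟨ cong (λ M → exp M k) (ℕₚ.+-comm N 1) ⟩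
  exp (suc N) k ∎
  where
  open ≡-Reasoning
  exp1 : (λ i → exp 0 i + E i) ≗ exp 1
  exp1 zero = refl
  exp1 (suc i) = trans (ℚₚ.+-identityˡ 1ℚ) (cong ℕ→ℚ (sym (ℕₚ.^-zeroˡ (suc i))))

-- The geometric series in e^t, telescoping through `exp-suc`. The constant 1 stands on the left to
-- avoid a difference of sequences.
powerSum-⋆-E : ∀ N k → exp 0 k + (powerSum N ⋆ E) k ≡ exp N k
powerSum-⋆-E zero k = trans (cong (exp 0 k +_) (zero-⋆ E k)) (ℚₚ.+-identityʳ _)
powerSum-⋆-E (suc N) k = begin
  exp 0 k + (powerSum (suc N) ⋆ E) k
    ≡⟨ cong (exp 0 k +_) (⋆-cong (λ i → ∑-last N (λ j → exp j i)) (λ _ → refl) k) ⟩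
  exp 0 k + ((λ i → powerSum N i + exp N i) ⋆ E) k
    ≡⟨ cong (exp 0 k +_) (⋆-distribʳ E (powerSum N) (exp N) k) ⟩
  exp 0 k + ((powerSum N ⋆ E) k + (exp N ⋆ E) k) ≡⟨ ℚₚ.+-assoc (exp 0 k) _ _ ⟨
  exp 0 k + (powerSum N ⋆ E) k + (exp N ⋆ E) k ≡⟨ cong (_+ (exp N ⋆ E) k) (powerSum-⋆-E N k) ⟩
  exp N k + (exp N ⋆ E) k ≡⟨ exp-suc N k ⟩
  exp (suc N) k ∎
  where open ≡-Reasoning

-- Bernoulli numbers: from the list recurrence to the generating function

at-++ˡ : ∀ xs ys k → k ℕ.< length xs → at (xs ++ ys) k ≡ at xs k
at-++ˡ (x ∷ xs) ys zero h = refl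
at-++ˡ (x ∷ xs) ys (suc k) (s≤s h) = at-++ˡ xs ys k h

at-++ʳ : ∀ xs y → at (xs ++ (y ∷ [])) (length xs) ≡ y
at-++ʳ [] y = refl
at-++ʳ (x ∷ xs) y = at-++ʳ xs y

length-bernUpTo : ∀ m → length (bernUpTo m) ≡ suc m
length-bernUpTo zero = refl
length-bernUpTo (suc m) = trans (Listₚ.length-++ (bernUpTo m))
    (trans (ℕₚ.+-comm _ 1) (cong suc (length-bernUpTo m)))

-- `bernUpTo` only appends, so an entry keeps its value in every longer list.
at-bernUpTo : ∀ j k → at (bernUpTo (j ℕ.+ k)) k ≡ B k
at-bernUpTo zero k = refl
at-bernUpTo (suc j) k = trans (at-++ˡ (bernUpTo (j ℕ.+ k)) _ k
  (subst (k ℕ.<_) (sym (length-bernUpTo (j ℕ.+ k))) (s≤s (ℕₚ.m≤n+m k j)))) (at-bernUpTo j k)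

sumℚ-map-applyUpTo : ∀ (g : ℕ → ℚ) h n → sumℚ (map g (applyUpTo h n)) ≡ ∑ n (g ∘ h)
sumℚ-map-applyUpTo g h zero = refl
sumℚ-map-applyUpTo g h (suc n) = cong (g (h 0) +_) (sumℚ-map-applyUpTo g (h ∘ suc) n)

B-suc : ∀ m → B (suc m) ≡ - (1/suc (suc m) * ∑ (suc m) (λ k → ℕ→ℚ (suc (suc m) C k) * B k))
B-suc m = begin
  at (bernUpTo m ++ (next ∷ [])) (suc m) ≡⟨ cong (at (bernUpTo m ++ (next ∷ []))) (length-bernUpTo m) ⟨
  at (bernUpTo m ++ (next ∷ [])) (length (bernUpTo m)) ≡⟨ at-++ʳ (bernUpTo m) next ⟩
  next
    ≡⟨ cong (λ s → - (1/suc (suc m) * s))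
        (trans (sumℚ-map-applyUpTo (λ k → ℕ→ℚ (suc (suc m) C k) * at (bernUpTo m) k) id (suc m))
            (∑-cong (suc m) λ k k<1+m →
            cong (ℕ→ℚ (suc (suc m) C k) *_) (earlier k (ℕₚ.≤-pred k<1+m)))) ⟩
  - (1/suc (suc m) * ∑ (suc m) (λ k → ℕ→ℚ (suc (suc m) C k) * B k)) ∎
  where
  open ≡-Reasoning
  next = nextBern (suc m) (bernUpTo m)
  earlier : ∀ k → k ℕ.≤ m → at (bernUpTo m) k ≡ B k
  earlier k k≤m = subst (λ i → at (bernUpTo i) k ≡ B k) (ℕₚ.m∸n+n≡m k≤m) (at-bernUpTo (m ∸ k) k)

[1+n]Cn≡1+n : ∀ n → suc n C n ≡ suc n
[1+n]Cn≡1+n zero = refl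
[1+n]Cn≡1+n (suc n) = trans (sym (nCk+nC[k+1]≡[n+1]C[k+1] (suc n) n))
    (trans (cong₂ ℕ._+_ ([1+n]Cn≡1+n n) (nCn≡1 (suc n))) (ℕₚ.+-comm _ 1))

B-recurrence : ∀ m → ∑ (suc (suc m)) (λ k → ℕ→ℚ (suc (suc m) C k) * B k) ≡ 0ℚ
B-recurrence m = begin
  ∑ (suc (suc m)) (λ k → ℕ→ℚ (suc (suc m) C k) * B k) ≡⟨ ∑-last (suc m) (λ k → ℕ→ℚ (suc (suc m) C k) * B k) ⟩
  s + ℕ→ℚ (suc (suc m) C suc m) * B (suc m) ≡⟨ cong₂ (λ x y → s + ℕ→ℚ x * y) ([1+n]Cn≡1+n (suc m)) (B-suc m) ⟩
  s + ℕ→ℚ (suc (suc m)) * (- (1/suc (suc m) * s))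
    ≡⟨ solve 3 (λ s q r → s :+ q :* (:- (r :* s)) := s :- (r :* q) :* s) refl s (ℕ→ℚ (suc (suc m)))
        (1/suc (suc m)) ⟩
  s - 1/suc (suc m) * ℕ→ℚ (suc (suc m)) * s ≡⟨ cong (λ x → s - x * s) (1/suc-inverseˡ (suc m)) ⟩
  s - 1ℚ * s ≡⟨ solve 1 (λ s → s :- con 1ℚ :* s := con 0ℚ) refl s ⟩
  0ℚ ∎
  where
  open ≡-Reasoning
  s = ∑ (suc m) (λ k → ℕ→ℚ (suc (suc m) C k) * B k)

∑-⋆-E : ∀ a n → (a ⋆ E) n ≡ ∑ n (λ k → ℕ→ℚ (n C k) * a k)
∑-⋆-E a n = begin
  (a ⋆ E) n ≡⟨ ⋆-binomial a E n ⟩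
  ∑ (suc n) (λ k → ℕ→ℚ (n C k) * (a k * E (n ∸ k))) ≡⟨ ∑-last n _ ⟩
  ∑ n (λ k → ℕ→ℚ (n C k) * (a k * E (n ∸ k))) + ℕ→ℚ (n C n) * (a n * E (n ∸ n))
    ≡⟨ cong₂ _+_ (∑-cong n (λ k k<n → cong (ℕ→ℚ (n C k) *_)
        (trans (cong (a k *_) (E-pos k<n)) (ℚₚ.*-identityʳ (a k)))))
        (trans (cong (λ i → ℕ→ℚ (n C n) * (a n * E i)) (ℕₚ.n∸n≡0 n))
          (trans (cong (ℕ→ℚ (n C n) *_) (ℚₚ.*-zeroʳ (a n))) (ℚₚ.*-zeroʳ (ℕ→ℚ (n C n))))) ⟩
  ∑ n (λ k → ℕ→ℚ (n C k) * a k) + 0ℚ ≡⟨ ℚₚ.+-identityʳ _ ⟩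
  ∑ n (λ k → ℕ→ℚ (n C k) * a k) ∎
  where
  open ≡-Reasoning
  E-pos : ∀ {k} → k ℕ.< n → E (n ∸ k) ≡ 1ℚ
  E-pos {k} k<n with n ∸ k | ℕₚ.m>n⇒m∸n≢0 k<n
  ... | zero | h with () ← h refl
  ... | suc _ | _ = refl

-- The definition of t/(e^t - 1) in product form; the recurrence starts at coefficient 2, and the
-- two before it are computed.
B-⋆-E : B ⋆ E ≗ X
B-⋆-E zero = refl
B-⋆-E (suc zero) = refl
B-⋆-E (suc (suc m)) = trans (∑-⋆-E B (suc (suc m))) (B-recurrence m)

-- The generating function (e^{Nt} − 1)/t.
expQuotient : ℕ → ℕ → ℚ
expQuotient N k = ℕ→ℚ (N ^ suc k) * 1/suc k

X-⋆-expQuotient : ∀ N k → exp 0 k + (X ⋆ expQuotient N) k ≡ exp N k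
X-⋆-expQuotient N zero = trans (cong (1ℚ +_) (X-⋆-zero (expQuotient N))) (ℚₚ.+-identityʳ 1ℚ)
X-⋆-expQuotient N (suc k) = begin
  0ℚ + (X ⋆ expQuotient N) (suc k) ≡⟨ ℚₚ.+-identityˡ _ ⟩
  (X ⋆ expQuotient N) (suc k) ≡⟨ X-⋆ (expQuotient N) k ⟩
  ℕ→ℚ (suc k) * (ℕ→ℚ (N ^ suc k) * 1/suc k)
    ≡⟨ solve 3 (λ x y z → x :* (y :* z) := y :* (z :* x)) refl (ℕ→ℚ (suc k)) (ℕ→ℚ (N ^ suc k)) (1/suc k) ⟩
  ℕ→ℚ (N ^ suc k) * (1/suc k * ℕ→ℚ (suc k)) ≡⟨ cong (ℕ→ℚ (N ^ suc k) *_) (1/suc-inverseˡ k) ⟩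
  ℕ→ℚ (N ^ suc k) * 1ℚ ≡⟨ ℚₚ.*-identityʳ _ ⟩
  exp N (suc k) ∎
  where open ≡-Reasoning

-- Multiplied by t = B(t)(e^t - 1), the left side becomes B(t)(e^{Nt} - 1) by the geometric series,
-- which is t · (e^{Nt} - 1)/t · B(t); then t is cancelled.
faulhaber : ∀ N → powerSum N ≗ expQuotient N ⋆ B
faulhaber N = X-⋆-cancel (powerSum N) (expQuotient N ⋆ B) λ n → begin
  (X ⋆ powerSum N) n ≡⟨ ⋆-cong (sym ∘ B-⋆-E) (λ _ → refl) n ⟩
  (B ⋆ E ⋆ powerSum N) n ≡⟨ ⋆-assoc B E (powerSum N) n ⟩
  (B ⋆ (E ⋆ powerSum N)) n ≡⟨ ⋆-cong (λ _ → refl) E⋆powerSum n ⟩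
  (B ⋆ (X ⋆ expQuotient N)) n ≡⟨ ⋆-comm B (X ⋆ expQuotient N) n ⟩
  (X ⋆ expQuotient N ⋆ B) n ≡⟨ ⋆-assoc X (expQuotient N) B n ⟩
  (X ⋆ (expQuotient N ⋆ B)) n ∎
  where
  open ≡-Reasoning
  E⋆powerSum : E ⋆ powerSum N ≗ X ⋆ expQuotient N
  E⋆powerSum k = trans (⋆-comm E (powerSum N) k) (+-cancelˡ (exp 0 k) _ _
    (trans (powerSum-⋆-E N k) (sym (X-⋆-expQuotient N k))))

-- The local ring at p

-- This bound and the next compare p^{k+1} with the denominator k + 2 in the power sum formula.
-- Equality occurs here at n = 0, which is what singles out p = 2.
2+n≤2^[1+n] : ∀ n → 2 ℕ.+ n ℕ.≤ 2 ^ suc n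
2+n≤2^[1+n] zero = ℕₚ.≤-refl
2+n≤2^[1+n] (suc n) = ℕₚ.≤-trans (ℕₚ.+-mono-≤ (ℕₚ.m^n>0 2 (suc n)) (2+n≤2^[1+n] n))
  (ℕₚ.≤-reflexive (cong (2 ^ suc n ℕ.+_) (sym (ℕₚ.+-identityʳ (2 ^ suc n)))))

3+n<2^[2+n] : ∀ n → 3 ℕ.+ n ℕ.< 2 ^ suc (suc n)
3+n<2^[2+n] zero = ℕₚ.≤-refl
3+n<2^[2+n] (suc n) = ℕₚ.≤-trans (ℕₚ.+-mono-≤ (ℕₚ.m^n>0 2 (suc (suc n))) (3+n<2^[2+n] n))
  (ℕₚ.≤-reflexive (cong (2 ^ suc (suc n) ℕ.+_) (sym (ℕₚ.+-identityʳ (2 ^ suc (suc n))))))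

-- x = u(mx) - v(nx). The hypothesis has the subtraction-free shape of Bézout's identity over the
-- naturals.
combination : ∀ {x} m n u v → 1 ℕ.+ v ℕ.* n ≡ u ℕ.* m → IsInt (ℕ→ℚ m * x) → IsInt (ℕ→ℚ n * x) → IsInt x
combination {x} m n u v eq mx nx = subst IsInt (sym x≡)
  (isInt-+ (isInt-* (isInt-ℕ u) mx) (isInt-neg (isInt-* (isInt-ℕ v) nx)))
  where
  open ≡-Reasoning
  bézout : 1ℚ + ℕ→ℚ v * ℕ→ℚ n ≡ ℕ→ℚ u * ℕ→ℚ m
  bézout = trans (cong (1ℚ +_) (sym (ℕ→ℚ-* v n))) (trans (sym (ℕ→ℚ-+ 1 (v ℕ.* n)))
      (trans (cong ℕ→ℚ eq) (ℕ→ℚ-* u m)))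
  x≡ : x ≡ ℕ→ℚ u * (ℕ→ℚ m * x) - ℕ→ℚ v * (ℕ→ℚ n * x)
  x≡ = begin
    x ≡⟨ solve 3 (λ x v e → x := (con 1ℚ :+ v :* e) :* x :- v :* (e :* x)) refl x (ℕ→ℚ v) (ℕ→ℚ n) ⟩
    (1ℚ + ℕ→ℚ v * ℕ→ℚ n) * x - ℕ→ℚ v * (ℕ→ℚ n * x) ≡⟨ cong (λ t → t * x - ℕ→ℚ v * (ℕ→ℚ n * x)) bézout ⟩
    ℕ→ℚ u * ℕ→ℚ m * x - ℕ→ℚ v * (ℕ→ℚ n * x) ≡⟨ cong (_- ℕ→ℚ v * (ℕ→ℚ n * x)) (ℚₚ.*-assoc (ℕ→ℚ u) (ℕ→ℚ m) x) ⟩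
    ℕ→ℚ u * (ℕ→ℚ m * x) - ℕ→ℚ v * (ℕ→ℚ n * x) ∎

-- Integral is membership in the localisation ℤ₍ₚ₎ and Divisible is membership in its ideal p ℤ₍ₚ₎.
module Localisation {p : ℕ} (prime-p : Prime p) where

  open Digits prime-p using (p≢0; 1<p)

  p∤1 : ¬ p ∣ 1
  p∤1 = >⇒∤ 1<p

  Integral : ℚ → Set
  Integral x = Σ ℕ λ e → ¬ p ∣ e × IsInt (ℕ→ℚ e * x)

  Divisible : ℚ → Set
  Divisible x = Σ ℚ λ y → Integral y × x ≡ ℕ→ℚ p * y

  integral-isInt : ∀ {x} → IsInt x → Integral x
  integral-isInt {x} h = 1 , p∤1 , subst IsInt (sym (ℚₚ.*-identityˡ x)) h

  ∤-* : ∀ {e f} → ¬ p ∣ e → ¬ p ∣ f → ¬ p ∣ e ℕ.* f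
  ∤-* {e} {f} p∤e p∤f h with euclidsLemma e f prime-p h
  ... | inj₁ p∣e = p∤e p∣e
  ... | inj₂ p∣f = p∤f p∣f

  integral-+ : ∀ {x y} → Integral x → Integral y → Integral (x + y)
  integral-+ {x} {y} (e , p∤e , ex) (f , p∤f , fy) = e ℕ.* f , ∤-* p∤e p∤f ,
    subst IsInt
      (trans (solve 4 (λ e f x y → f :* (e :* x) :+ e :* (f :* y) := e :* f :* (x :+ y)) refl (ℕ→ℚ e)
          (ℕ→ℚ f) x y)
        (cong (_* (x + y)) (sym (ℕ→ℚ-* e f))))
      (isInt-+ (isInt-* (isInt-ℕ f) ex) (isInt-* (isInt-ℕ e) fy))

  integral-* : ∀ {x y} → Integral x → Integral y → Integral (x * y)
  integral-* {x} {y} (e , p∤e , ex) (f , p∤f , fy) = e ℕ.* f , ∤-* p∤e p∤f ,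
    subst IsInt
      (trans (solve 4 (λ e f x y → (e :* x) :* (f :* y) := e :* f :* (x :* y)) refl (ℕ→ℚ e) (ℕ→ℚ f) x y)
        (cong (_* (x * y)) (sym (ℕ→ℚ-* e f))))
      (isInt-* ex fy)

  integral-ℕ : ∀ n → Integral (ℕ→ℚ n)
  integral-ℕ n = integral-isInt (isInt-ℕ n)

  integral-1/suc : ∀ n → ¬ p ∣ suc n → Integral (1/suc n)
  integral-1/suc n h = suc n , h , ℤ.+ 1 , trans (ℚₚ.*-comm (ℕ→ℚ (suc n)) (1/suc n)) (1/suc-inverseˡ n)

  integral-neg : ∀ {x} → Integral x → Integral (- x)
  integral-neg {x} (e , p∤e , ex) = e , p∤e , subst IsInt (ℚₚ.neg-distribʳ-* (ℕ→ℚ e) x) (isInt-neg ex)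

  divisible-+ : ∀ {x y} → Divisible x → Divisible y → Divisible (x + y)
  divisible-+ (x′ , hx , ex) (y′ , hy , ey) = x′ + y′ , integral-+ hx hy , trans (cong₂ _+_ ex ey)
      (sym (ℚₚ.*-distribˡ-+ (ℕ→ℚ p) x′ y′))

  divisible-*ˡ : ∀ {x y} → Integral x → Divisible y → Divisible (x * y)
  divisible-*ˡ {x} hx (y′ , hy , ey) = x * y′ , integral-* hx hy ,
    trans (cong (x *_) ey) (solve 3 (λ x q y → x :* (q :* y) := q :* (x :* y)) refl x (ℕ→ℚ p) y′)

  divisible-*ʳ : ∀ {x y} → Divisible x → Integral y → Divisible (x * y)
  divisible-*ʳ {x} {y} hx hy = subst Divisible (ℚₚ.*-comm y x) (divisible-*ˡ hy hx)

  divisible-neg : ∀ {x} → Divisible x → Divisible (- x)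
  divisible-neg (x′ , hx , ex) = - x′ , integral-neg hx , trans (cong -_ ex) (ℚₚ.neg-distribʳ-* (ℕ→ℚ p) x′)

  divisible-- : ∀ {x y} → Divisible x → Divisible y → Divisible (x - y)
  divisible-- hx hy = divisible-+ hx (divisible-neg hy)

  divisible⇒integral : ∀ {x} → Divisible x → Integral x
  divisible⇒integral (x′ , hx , ex) = subst Integral (sym ex) (integral-* (integral-ℕ p) hx)

  divisible-p* : ∀ {x} → Integral x → Divisible (ℕ→ℚ p * x)
  divisible-p* {x} h = x , h , refl

  divisible-p*⁻¹ : ∀ {x} → Divisible (ℕ→ℚ p * x) → Integral x
  divisible-p*⁻¹ {x} (y , hy , e) = subst Integral (sym (*-cancelˡ-ℕ p e)) hy

  divisible-ℕ : ∀ {n} → p ∣ n → Divisible (ℕ→ℚ n)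
  divisible-ℕ {n} (divides q eq) = ℕ→ℚ q , integral-ℕ q , trans (cong ℕ→ℚ (trans eq (ℕₚ.*-comm q p)))
      (ℕ→ℚ-* p q)

  -- If e clears the denominator of n/p, then e n = z p with p ∤ e, and Euclid's lemma returns the
  -- divisibility to ℕ.
  divisible-ℕ⁻¹ : ∀ {n} → Divisible (ℕ→ℚ n) → p ∣ n
  divisible-ℕ⁻¹ {n} (y , (e , p∤e , z , ey) , eq) = case (euclidsLemma e n prime-p (divides ℤ.∣ z ∣ en))
    where
    open ≡-Reasoning
    en′ : ι (ℤ.+ (e ℕ.* n)) ≡ ι (z ℤ.* ℤ.+ p)
    en′ = begin
      ℕ→ℚ (e ℕ.* n) ≡⟨ ℕ→ℚ-* e n ⟩
      ℕ→ℚ e * ℕ→ℚ n ≡⟨ cong (ℕ→ℚ e *_) eq ⟩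
      ℕ→ℚ e * (ℕ→ℚ p * y) ≡⟨ solve 3 (λ e p y → e :* (p :* y) := (e :* y) :* p) refl (ℕ→ℚ e) (ℕ→ℚ p) y ⟩
      ℕ→ℚ e * y * ℕ→ℚ p ≡⟨ cong (_* ℕ→ℚ p) ey ⟩
      ι z * ℕ→ℚ p ≡⟨ ι-* z (ℤ.+ p) ⟨
      ι (z ℤ.* ℤ.+ p) ∎
    en : e ℕ.* n ≡ ℤ.∣ z ∣ ℕ.* p
    en = trans (cong ℤ.∣_∣ (ι-injective {ℤ.+ (e ℕ.* n)} {z ℤ.* ℤ.+ p} en′)) (ℤₚ.abs-* z (ℤ.+ p))
    case : p ∣ e ⊎ p ∣ n → p ∣ n
    case (inj₁ h) = ⊥-elim (p∤e h)
    case (inj₂ h) = h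

  divisible-cancel : ∀ n {x} → ¬ p ∣ n → Divisible (ℕ→ℚ n * x) → Divisible x
  divisible-cancel zero p∤n _ = ⊥-elim (p∤n (p ∣0))
  divisible-cancel (suc n) {x} p∤n h = subst Divisible eq (divisible-*ˡ (integral-1/suc n p∤n) h)
    where
    eq : 1/suc n * (ℕ→ℚ (suc n) * x) ≡ x
    eq = trans (sym (ℚₚ.*-assoc (1/suc n) (ℕ→ℚ (suc n)) x))
        (trans (cong (_* x) (1/suc-inverseˡ n)) (ℚₚ.*-identityˡ x))

  integral-∑ : ∀ n f → (∀ k → k ℕ.< n → Integral (f k)) → Integral (∑ n f)
  integral-∑ zero f h = integral-ℕ 0
  integral-∑ (suc n) f h = integral-+ (h 0 (s≤s z≤n)) (integral-∑ n (f ∘ suc) (λ k k<n → h (suc k) (s≤s k<n)))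

  divisible-0 : Divisible 0ℚ
  divisible-0 = divisible-ℕ (p ∣0)

  divisible-∑ : ∀ n f → (∀ k → k ℕ.< n → Divisible (f k)) → Divisible (∑ n f)
  divisible-∑ zero f h = divisible-0
  divisible-∑ (suc n) f h = divisible-+ (h 0 (s≤s z≤n))
      (divisible-∑ n (f ∘ suc) (λ k k<n → h (suc k) (s≤s k<n)))

  ∑-congruent : ∀ n f g → (∀ k → k ℕ.< n → Divisible (f k - g k)) → Divisible (∑ n f - ∑ n g)
  ∑-congruent zero f g h = divisible-0
  ∑-congruent (suc n) f g h = subst Divisible
    (solve 4 (λ a b c d → (a :- c) :+ (b :- d) := (a :+ b) :- (c :+ d)) refl (f 0) (∑ n (f ∘ suc)) (g 0)
        (∑ n (g ∘ suc)))
    (divisible-+ (h 0 (s≤s z≤n)) (∑-congruent n (f ∘ suc) (g ∘ suc) (λ k k<n → h (suc k) (s≤s k<n))))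

  -- N < p^j forces the p-adic valuation of N below j. The induction cancels p from p^j and N
  -- together until N is prime to p, and the bound leaves at least one p on top.
  divisible-p^j/N : ∀ j n → suc n ℕ.< p ^ j → Divisible (ℕ→ℚ (p ^ j) * 1/suc n)
  divisible-p^j/N zero n (s≤s ())
  divisible-p^j/N (suc j) n lt with p ∣? suc n
  ... | no p∤N = divisible-*ʳ (divisible-ℕ (m∣m*n (p ^ j))) (integral-1/suc n p∤N)
  ... | yes (divides (suc m) eq) = subst Divisible (*-cancelˡ-ℕ (suc n) same) (divisible-p^j/N j m lt′)
    where
    open ≡-Reasoning
    lt′ : suc m ℕ.< p ^ j
    lt′ = ℕₚ.*-cancelˡ-< p (suc m) (p ^ j) (subst (ℕ._< p ^ suc j) (trans eq (ℕₚ.*-comm (suc m) p)) lt)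
    a = ℕ→ℚ (p ^ j)
    same : ℕ→ℚ (suc n) * (a * 1/suc m) ≡ ℕ→ℚ (suc n) * (ℕ→ℚ (p ^ suc j) * 1/suc n)
    same = begin
      ℕ→ℚ (suc n) * (a * 1/suc m) ≡⟨ cong (_* (a * 1/suc m)) (trans (cong ℕ→ℚ eq) (ℕ→ℚ-* (suc m) p)) ⟩
      ℕ→ℚ (suc m) * ℕ→ℚ p * (a * 1/suc m)
        ≡⟨ solve 4 (λ m p a i → m :* p :* (a :* i) := p :* a :* (i :* m)) refl (ℕ→ℚ (suc m)) (ℕ→ℚ p) a
            (1/suc m) ⟩
      ℕ→ℚ p * a * (1/suc m * ℕ→ℚ (suc m))
        ≡⟨ cong₂ _*_ (sym (ℕ→ℚ-* p (p ^ j))) (trans (1/suc-inverseˡ m) (sym (1/suc-inverseˡ n))) ⟩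
      ℕ→ℚ (p ^ suc j) * (1/suc n * ℕ→ℚ (suc n))
        ≡⟨ solve 3 (λ b i n → b :* (i :* n) := n :* (b :* i)) refl (ℕ→ℚ (p ^ suc j)) (1/suc n) (ℕ→ℚ (suc n)) ⟩
      ℕ→ℚ (suc n) * (ℕ→ℚ (p ^ suc j) * 1/suc n) ∎

  -- The passage from local to global: p and the local denominator e both clear x, and they are
  -- coprime.
  integral-int : ∀ {x} → Integral x → IsInt (ℕ→ℚ p * x) → IsInt x
  integral-int {x} (e , p∤e , ex) px with coprime-Bézout coprime
    where
    coprime : Coprime p e
    coprime (d∣p , d∣e) with prime⇒irreducible prime-p d∣p
    ... | inj₁ d≡1 = d≡1
    ... | inj₂ refl = ⊥-elim (p∤e d∣e)
  ... | Bézout.Identity.+- u v eq = combination p e u v eq px ex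
  ... | Bézout.Identity.-+ u v eq = combination e p v u eq ex px

-- Power sums modulo p and the von Staudt–Clausen theorem

exp-1 : ∀ k → exp 1 k ≡ 1ℚ
exp-1 k = cong ℕ→ℚ (ℕₚ.^-zeroˡ k)

∑-1 : ∀ n → ∑ n (λ _ → 1ℚ) ≡ ℕ→ℚ n
∑-1 zero = refl
∑-1 (suc n) = trans (cong (1ℚ +_) (∑-1 n)) (sym (ℕ→ℚ-+ 1 n))

module VonStaudt {p : ℕ} (prime-p : Prime p) where
  open Localisation prime-p
  open Digits prime-p

  -- Induction on a: (a + 1)^p is expanded as a coefficient of e^{at}e^t, and its middle terms
  -- contain C(p, k).
  fermat-suc : ∀ q → suc q ≡ p → ∀ a → Divisible (exp a (suc q) - ℕ→ℚ a)
  fermat-suc q 1+q≡p zero = divisible-0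
  fermat-suc q 1+q≡p (suc a) = subst Divisible eq (divisible-+ mid-divisible (fermat-suc q 1+q≡p a))
    where
    open ≡-Reasoning
    f : ℕ → ℚ
    f k = ℕ→ℚ (suc q C k) * (exp a k * exp 1 (suc q ∸ k))
    mid = ∑ q (f ∘ suc)
    mid-divisible : Divisible mid
    mid-divisible = divisible-∑ q (f ∘ suc) λ k k<q → divisible-*ʳ (divisible-ℕ (p∣pCk 1+q≡p k<q))
      (integral-* (integral-ℕ (a ^ suc k)) (integral-ℕ (1 ^ (q ∸ k))))
    first : f 0 ≡ 1ℚ
    first = trans (ℚₚ.*-identityˡ (1ℚ * exp 1 (suc q)))
        (trans (ℚₚ.*-identityˡ (exp 1 (suc q))) (exp-1 (suc q)))
    final : f (suc q) ≡ exp a (suc q)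
    final = trans (cong₂ (λ c e → ℕ→ℚ c * (exp a (suc q) * e)) (nCn≡1 (suc q)) (exp-1 (q ∸ q)))
      (trans (ℚₚ.*-identityˡ (exp a (suc q) * 1ℚ)) (ℚₚ.*-identityʳ (exp a (suc q))))
    expand : exp (suc a) (suc q) ≡ 1ℚ + (mid + exp a (suc q))
    expand = begin
      exp (suc a) (suc q) ≡⟨ cong (λ b → exp b (suc q)) (ℕₚ.+-comm 1 a) ⟩
      exp (a ℕ.+ 1) (suc q) ≡⟨ exp-⋆ a 1 (suc q) ⟨
      (exp a ⋆ exp 1) (suc q) ≡⟨ ⋆-binomial (exp a) (exp 1) (suc q) ⟩
      f 0 + ∑ (suc q) (f ∘ suc) ≡⟨ cong₂ _+_ first (trans (∑-last q (f ∘ suc)) (cong (mid +_) final)) ⟩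
      1ℚ + (mid + exp a (suc q)) ∎
    eq : mid + (exp a (suc q) - ℕ→ℚ a) ≡ exp (suc a) (suc q) - ℕ→ℚ (suc a)
    eq = begin
      mid + (exp a (suc q) - ℕ→ℚ a)
        ≡⟨ solve 3 (λ m e a → m :+ (e :- a) := (con 1ℚ :+ (m :+ e)) :- (con 1ℚ :+ a)) refl mid (exp a (suc q))
            (ℕ→ℚ a) ⟩
      (1ℚ + (mid + exp a (suc q))) - (1ℚ + ℕ→ℚ a) ≡⟨ cong₂ _-_ expand (ℕ→ℚ-+ 1 a) ⟨
      exp (suc a) (suc q) - ℕ→ℚ (suc a) ∎

  fermat : ∀ a → Divisible (exp a (suc r) - ℕ→ℚ a)
  fermat = fermat-suc r 1+r≡p

  fermat-unit : ∀ a → ¬ p ∣ a → Divisible (exp a r - 1ℚ)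
  fermat-unit a p∤a = divisible-cancel a p∤a (subst Divisible eq (fermat a))
    where
    eq : exp a (suc r) - ℕ→ℚ a ≡ ℕ→ℚ a * (exp a r - 1ℚ)
    eq = trans (cong (_- ℕ→ℚ a) (ℕ→ℚ-* a (a ^ r)))
      (solve 2 (λ a e → a :* e :- a := a :* (e :- con 1ℚ)) refl (ℕ→ℚ a) (exp a r))

  -- Coefficient k + 1 of the geometric series gives p^{k+1} = Σ_{i≤k} C(k + 1, i) S_i, where S_i is
  -- the power sum. All S_i with i < k are divisible by induction, and the factor k + 1 of S_k is
  -- prime to p.
  powerSum-small : ∀ k → suc k ℕ.< p → Divisible (powerSum p k)
  powerSum-small = <-rec _ λ k rec 1+k<p →
    let T = ∑ k (λ i → ℕ→ℚ (suc k C i) * powerSum p i)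
        open ≡-Reasoning
        eq : exp p (suc k) - T ≡ ℕ→ℚ (suc k) * powerSum p k
        eq = begin
          exp p (suc k) - T ≡⟨ cong (_- T) (powerSum-⋆-E p (suc k)) ⟨
          (0ℚ + (powerSum p ⋆ E) (suc k)) - T
            ≡⟨ cong (λ x → (0ℚ + x) - T) (trans (∑-⋆-E (powerSum p) (suc k))
                (∑-last k (λ i → ℕ→ℚ (suc k C i) * powerSum p i))) ⟩
          (0ℚ + (T + ℕ→ℚ (suc k C k) * powerSum p k)) - T
            ≡⟨ solve 2 (λ t x → (con 0ℚ :+ (t :+ x)) :- t := x) refl T (ℕ→ℚ (suc k C k) * powerSum p k) ⟩
          ℕ→ℚ (suc k C k) * powerSum p k ≡⟨ cong (λ c → ℕ→ℚ c * powerSum p k) ([1+n]Cn≡1+n k) ⟩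
          ℕ→ℚ (suc k) * powerSum p k ∎
    in divisible-cancel (suc k) (>⇒∤ 1+k<p) (subst Divisible eq (divisible-- (divisible-ℕ (m∣m*n (p ^ k)))
         (divisible-∑ k _ λ i i<k → divisible-*ˡ (integral-ℕ (suc k C i))
             (rec i<k (ℕₚ.<-trans (s≤s i<k) 1+k<p)))))

  -- Summation of a^{k-1}(a^p - a). The case k = 0 would be false: modulo p the sum is 0 at exponent
  -- 0 and -1 at exponent r.
  powerSum-period : ∀ k → 0 ℕ.< k → Divisible (powerSum p (r ℕ.+ k) - powerSum p k)
  powerSum-period (suc k) _ = ∑-congruent p (λ a → exp a (r ℕ.+ suc k)) (λ a → exp a (suc k)) λ a _ →
      subst Divisible (eq a) (divisible-*ˡ (integral-ℕ (a ^ k)) (fermat a))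
    where
    eq : ∀ a → ℕ→ℚ (a ^ k) * (exp a (suc r) - ℕ→ℚ a) ≡ exp a (r ℕ.+ suc k) - exp a (suc k)
    eq a = trans (solve 3 (λ x y z → x :* (y :- z) := x :* y :- z :* x) refl (exp a k) (exp a (suc r))
        (ℕ→ℚ a))
      (cong₂ _-_
        (trans (sym (ℕ→ℚ-* (a ^ k) (a ^ suc r)))
          (cong ℕ→ℚ (trans (sym (ℕₚ.^-distribˡ-+-* a k (suc r)))
              (cong (a ^_) (trans (ℕₚ.+-suc k r) (ℕₚ.+-comm (suc k) r))))))
        (sym (ℕ→ℚ-* a (a ^ k))))

  powerSum-r : Divisible (powerSum p r + 1ℚ)
  powerSum-r = subst (λ q → Divisible (powerSum q r + 1ℚ)) 1+r≡p (subst Divisible eq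
      (divisible-+ (∑-congruent r (λ i → exp (suc i) r) (λ _ → 1ℚ)
        λ i i<r → fermat-unit (suc i) (>⇒∤ (subst (suc i ℕ.<_) 1+r≡p (s≤s i<r))))
      (divisible-ℕ (∣-reflexive (sym 1+r≡p)))))
    where
    S = ∑ r (λ i → exp (suc i) r)
    open ≡-Reasoning
    -- The summand i = 0 vanishes only for a positive exponent, which leaves the r units 1, ..., p -
    -- 1.
    0^r : ∀ {n} → 0 ℕ.< n → exp 0 n ≡ 0ℚ
    0^r (s≤s _) = refl
    eq : (S - ∑ r (λ _ → 1ℚ)) + ℕ→ℚ (suc r) ≡ powerSum (suc r) r + 1ℚ
    eq = begin
      (S - ∑ r (λ _ → 1ℚ)) + ℕ→ℚ (suc r) ≡⟨ cong₂ (λ x y → (S - x) + y) (∑-1 r) (ℕ→ℚ-+ 1 r) ⟩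
      (S - ℕ→ℚ r) + (1ℚ + ℕ→ℚ r)
        ≡⟨ solve 2 (λ s r → (s :- r) :+ (con 1ℚ :+ r) := (con 0ℚ :+ s) :+ con 1ℚ) refl S (ℕ→ℚ r) ⟩
      (0ℚ + S) + 1ℚ ≡⟨ cong (λ x → (x + S) + 1ℚ) (0^r 0<r) ⟨
      powerSum (suc r) r + 1ℚ ∎

  powerSum-multiple : ∀ t → Divisible (powerSum p (suc t ℕ.* r) + 1ℚ)
  powerSum-multiple zero = subst (λ k → Divisible (powerSum p k + 1ℚ)) (sym (ℕₚ.+-identityʳ r)) powerSum-r
  powerSum-multiple (suc t) = subst Divisible
    (solve 3 (λ a b c → (a :- b) :+ (b :+ c) := a :+ c) refl (powerSum p (suc (suc t) ℕ.* r))
        (powerSum p (suc t ℕ.* r)) 1ℚ)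
    (divisible-+ (powerSum-period (suc t ℕ.* r) (ℕₚ.≤-trans 0<r (ℕₚ.m≤m+n r (t ℕ.* r))))
        (powerSum-multiple t))

  -- Descent by r: a non-multiple of r stays positive, as the period requires, until it drops below
  -- r.
  powerSum-nonmultiple : ∀ k → ¬ r ∣ k → Divisible (powerSum p k)
  powerSum-nonmultiple = <-rec _ step
    where
    step : ∀ k → (∀ {i} → i ℕ.< k → ¬ r ∣ i → Divisible (powerSum p i)) → ¬ r ∣ k → Divisible (powerSum p k)
    step k rec r∤k with k ℕ.<? r
    ... | yes k<r = powerSum-small k (subst (suc k ℕ.<_) 1+r≡p (s≤s k<r))
    ... | no k≮r = subst Divisible eq (divisible-+ (powerSum-period k′ 0<k′) (rec k′<k r∤k′))
      where
      k′ = k ∸ r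
      r≤k = ℕₚ.≮⇒≥ k≮r
      k≡ : r ℕ.+ k′ ≡ k
      k≡ = ℕₚ.m+[n∸m]≡n r≤k
      r∤k′ : ¬ r ∣ k′
      r∤k′ h = r∤k (subst (r ∣_) k≡ (∣m∣n⇒∣m+n ∣-refl h))
      0<k′ : 0 ℕ.< k′
      0<k′ = ℕₚ.n≢0⇒n>0 λ e → r∤k′ (subst (r ∣_) (sym e) (r ∣0))
      k′<k : k′ ℕ.< k
      k′<k = subst (k′ ℕ.<_) k≡ (ℕₚ.m<n+m k′ 0<r)
      eq : (powerSum p (r ℕ.+ k′) - powerSum p k′) + powerSum p k′ ≡ powerSum p k
      eq = trans (solve 2 (λ a b → (a :- b) :+ b := a) refl (powerSum p (r ℕ.+ k′)) (powerSum p k′))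
          (cong (powerSum p) k≡)

  -- The factor p^{j+1}/(j + 1) for j = k + 1 with one p taken out. That p is given to the Bernoulli
  -- number, since pB is what the induction knows to be integral.
  weight : ℕ → ℚ
  weight k = ℕ→ℚ (p ^ suc k) * 1/suc (suc k)

  2^k≤p^k : ∀ k → 2 ^ k ℕ.≤ p ^ k
  2^k≤p^k k = ℕₚ.^-monoˡ-≤ k 1<p

  weight-integral : ∀ k → Integral (weight k)
  weight-integral k with suc (suc k) ℕ.<? p ^ suc k
  ... | yes h = divisible⇒integral (divisible-p^j/N (suc k) (suc k) h)
  -- The boundary case p^{k+1} = k + 2, that is p = 2 and k = 0, where the weight is exactly 1.
  ... | no h = subst Integral (sym eq) (integral-ℕ 1)
    where
    eq : weight k ≡ 1ℚ
    eq = trans (cong (λ x → ℕ→ℚ x * 1/suc (suc k))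
        (ℕₚ.≤-antisym (ℕₚ.≮⇒≥ h) (ℕₚ.≤-trans (2+n≤2^[1+n] k) (2^k≤p^k (suc k)))))
      (trans (ℚₚ.*-comm (ℕ→ℚ (suc (suc k))) (1/suc (suc k))) (1/suc-inverseˡ (suc k)))

  weight-divisible : ∀ k → 3 ℕ.≤ p ⊎ 0 ℕ.< k → Divisible (weight k)
  weight-divisible zero (inj₁ 3≤p) = divisible-p^j/N 1 1 (subst (3 ℕ.≤_) (sym (ℕₚ.*-identityʳ p)) 3≤p)
  weight-divisible (suc k) _ = divisible-p^j/N (suc (suc k)) (suc (suc k))
      (ℕₚ.≤-trans (3+n<2^[2+n] k) (2^k≤p^k (suc (suc k))))

  tailTerm : ℕ → ℕ → ℚ
  tailTerm m k = ℕ→ℚ (m C suc k) * (weight k * (ℕ→ℚ p * B (m ∸ suc k)))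

  powerSum-B : ∀ m → powerSum p m ≡ ℕ→ℚ p * B m + ∑ m (tailTerm m)
  powerSum-B m = begin
    powerSum p m ≡⟨ faulhaber p m ⟩
    (expQuotient p ⋆ B) m ≡⟨ ⋆-binomial (expQuotient p) B m ⟩
    f 0 + ∑ m (f ∘ suc) ≡⟨ cong₂ _+_ first (∑-cong m λ k _ → other k) ⟩
    ℕ→ℚ p * B m + ∑ m (tailTerm m) ∎
    where
    open ≡-Reasoning
    f : ℕ → ℚ
    f k = ℕ→ℚ (m C k) * (expQuotient p k * B (m ∸ k))
    first : f 0 ≡ ℕ→ℚ p * B m
    first = trans (ℚₚ.*-identityˡ (expQuotient p 0 * B m))
        (cong (_* B m) (trans (ℚₚ.*-identityʳ (ℕ→ℚ (p ^ 1))) (cong ℕ→ℚ (ℕₚ.*-identityʳ p))))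
    other : ∀ k → f (suc k) ≡ tailTerm m k
    other k = cong (ℕ→ℚ (m C suc k) *_)
        (trans (cong (λ x → x * 1/suc (suc k) * B (m ∸ suc k)) (ℕ→ℚ-* p (p ^ suc k)))
      (solve 4 (λ p x y b → p :* x :* y :* b := x :* y :* (p :* b)) refl (ℕ→ℚ p) (ℕ→ℚ (p ^ suc k))
          (1/suc (suc k)) (B (m ∸ suc k))))

  pB-from-powerSum : ∀ m → powerSum p m - ∑ m (tailTerm m) ≡ ℕ→ℚ p * B m
  pB-from-powerSum m = trans (cong (_- ∑ m (tailTerm m)) (powerSum-B m))
    (solve 2 (λ a b → (a :+ b) :- b := a) refl (ℕ→ℚ p * B m) (∑ m (tailTerm m)))

  -- The tail contains pB only at smaller indices, with integral weights, so strong induction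
  -- applies.
  integral-pB : ∀ m → Integral (ℕ→ℚ p * B m)
  integral-pB = <-rec _ λ m rec → subst Integral (pB-from-powerSum m) (integral-+
    (integral-∑ p _ λ i _ → integral-ℕ (i ^ m))
    (integral-neg (integral-∑ m _ λ k k<m → integral-* (integral-ℕ (m C suc k))
        (integral-* (weight-integral k) (rec (ℕₚ.∸-monoʳ-< (s≤s z≤n) k<m))))))

  -- For p = 2 the term k = 0 of the tail, which is m · 2B_{m−1}, need not vanish modulo 2.
  Regular : ℕ → Set
  Regular m = 3 ℕ.≤ p ⊎ p ∣ m ⊎ m ≡ 1

  tail-divisible : ∀ m → Regular m → Divisible (∑ m (tailTerm m))
  tail-divisible m reg = divisible-∑ m (tailTerm m) λ k _ → term m k reg
    where
    byWeight : ∀ m k → 3 ℕ.≤ p ⊎ 0 ℕ.< k → Divisible (tailTerm m k)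
    byWeight m k h = divisible-*ˡ (integral-ℕ (m C suc k))
        (divisible-*ʳ (weight-divisible k h) (integral-pB (m ∸ suc k)))
    term : ∀ m k → Regular m → Divisible (tailTerm m k)
    term m (suc k) _ = byWeight m (suc k) (inj₂ (s≤s z≤n))
    term m zero (inj₁ 3≤p) = byWeight m zero (inj₁ 3≤p)
    -- The weight may be 1 here; the factor p comes from C(m, 1) = m, and in the next case from pB_0
    -- = p.
    term m zero (inj₂ (inj₁ p∣m)) = divisible-*ʳ (divisible-ℕ (subst (p ∣_) (sym (nC1≡n m)) p∣m))
      (integral-* (weight-integral 0) (integral-pB (m ∸ 1)))
    term .1 zero (inj₂ (inj₂ refl)) = divisible-*ˡ (integral-ℕ 1)
        (divisible-*ˡ (weight-integral 0) (divisible-p* (integral-ℕ 1)))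

  vonStaudt : ∀ m → Regular m → 0 ℕ.< m → r ∣ m → Divisible (ℕ→ℚ p * B m + 1ℚ)
  vonStaudt .0 reg () (divides zero refl)
  vonStaudt m@.(suc t ℕ.* r) reg _ (divides (suc t) refl) = subst Divisible eq
      (divisible-- (powerSum-multiple t) (tail-divisible m reg))
    where
    S = powerSum p m
    T = ∑ m (tailTerm m)
    eq : (S + 1ℚ) - T ≡ ℕ→ℚ p * B m + 1ℚ
    eq = trans (solve 3 (λ s o t → (s :+ o) :- t := (s :- t) :+ o) refl S 1ℚ T)
        (cong (_+ 1ℚ) (pB-from-powerSum m))

  integral-B : ∀ m → 3 ℕ.≤ p → ¬ r ∣ m → Integral (B m)
  integral-B m 3≤p r∤m = divisible-p*⁻¹ (subst Divisible (pB-from-powerSum m)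
    (divisible-- (powerSum-nonmultiple m r∤m) (tail-divisible m (inj₁ 3≤p))))

  -- From c = c(pB_m + 1) - p(cB_m): integrality of cB_m would make p divide c.
  nonintegral-B : ∀ m c → Regular m → 0 ℕ.< m → r ∣ m → ¬ p ∣ c → ¬ Integral (ℕ→ℚ c * B m)
  nonintegral-B m c reg 0<m r∣m p∤c h = p∤c (divisible-ℕ⁻¹ (subst Divisible
    (solve 3 (λ c p b → c :* (p :* b :+ con 1ℚ) :- p :* (c :* b) := c) refl (ℕ→ℚ c) (ℕ→ℚ p) (B m))
    (divisible-- (divisible-*ˡ (integral-ℕ c) (vonStaudt m reg 0<m r∣m)) (divisible-p* h))))

-- Fractional parts

floor-mkℚ+ : ∀ a b .{{_ : ℕ.NonZero b}} .(c : Coprime a b) → floor (mkℚ+ a b c) ≡ ℤ.+ (a ℕ./ b)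
floor-mkℚ+ a (suc b) c = ℤ-DivMod.div-pos-is-/ℕ (ℤ.+ a) (suc b)

-- `_/_` reduces by the gcd before `floor` divides; cancelling the gcd leaves the integer quotient
-- unchanged.
floor-/ : ∀ n k .{{_ : ℕ.NonZero k}} → floor (ℤ.+ n / k) ≡ ℤ.+ (n ℕ./ k)
floor-/ n k@(suc _) = trans (floor-mkℚ+ (n ℕ./ g) (k ℕ./ g) _) (cong ℤ.+_ (begin
  (n ℕ./ g) ℕ./ (k ℕ./ g) ≡⟨ m*n/m*o≡n/o g (n ℕ./ g) (k ℕ./ g) ⟨
  (g ℕ.* (n ℕ./ g)) ℕ./ (g ℕ.* (k ℕ./ g))
    ≡⟨ trans (/-congˡ (g*[m/g] n (gcd[m,n]∣m n k))) (/-congʳ (g*[m/g] k (gcd[m,n]∣n n k))) ⟩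
  n ℕ./ k ∎))
  where
  open ≡-Reasoning
  g = gcd n k
  instance
    g≢0 : ℕ.NonZero g
    g≢0 = ℕ.≢-nonZero (gcd[m,n]≢0 n k (inj₂ λ ()))
  g*[m/g] : ∀ m → g ∣ m → g ℕ.* (m ℕ./ g) ≡ m
  g*[m/g] m g∣m = trans (ℕₚ.*-comm g (m ℕ./ g)) (m/n*n≡m g∣m)
  instance
    k/g≢0 : ℕ.NonZero (k ℕ./ g)
    k/g≢0 = ℕ.≢-nonZero λ e → ℕₚ.1+n≢0 (trans (sym (g*[m/g] k (gcd[m,n]∣n n k)))
        (trans (cong (g ℕ.*_) e) (ℕₚ.*-zeroʳ g)))
    gk/g≢0 : ℕ.NonZero (g ℕ.* (k ℕ./ g))
    gk/g≢0 = ℕₚ.m*n≢0 g (k ℕ./ g)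

frac-/ : ∀ m q k .{{_ : ℕ.NonZero k}} → m ℕ.< k → frac (ℤ.+ (m ℕ.+ q ℕ.* k) / k) * ℕ→ℚ k ≡ ℕ→ℚ m
frac-/ m q k m<k = begin
  (x - ι (floor x)) * ℕ→ℚ k ≡⟨ cong (λ z → (x - ι z) * ℕ→ℚ k) (trans (floor-/ n k) (cong ℤ.+_ n/k≡q)) ⟩
  (x - ℕ→ℚ q) * ℕ→ℚ k ≡⟨ solve 3 (λ x q k → (x :- q) :* k := x :* k :- q :* k) refl x (ℕ→ℚ q) (ℕ→ℚ k) ⟩
  x * ℕ→ℚ k - ℕ→ℚ q * ℕ→ℚ k ≡⟨ cong₂ _-_ (/-* (ℤ.+ n) k) (sym (ℕ→ℚ-* q k)) ⟩
  ℕ→ℚ n - ℕ→ℚ (q ℕ.* k) ≡⟨ cong (_- ℕ→ℚ (q ℕ.* k)) (ℕ→ℚ-+ m (q ℕ.* k)) ⟩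
  ℕ→ℚ m + ℕ→ℚ (q ℕ.* k) - ℕ→ℚ (q ℕ.* k) ≡⟨ solve 2 (λ m q → (m :+ q) :- q := m) refl (ℕ→ℚ m) (ℕ→ℚ (q ℕ.* k)) ⟩
  ℕ→ℚ m ∎
  where
  open ≡-Reasoning
  n = m ℕ.+ q ℕ.* k
  x = ℤ.+ n / k
  n/k≡q : n ℕ./ k ≡ q
  n/k≡q = trans (+-distrib-/-∣ʳ m (n∣m*n q)) (cong₂ ℕ._+_ (m<n⇒m/n≡0 m<k) (m*n/n≡m q k))

ℕ→ℚ-mono-< : ∀ {a b} → a ℕ.< b → ℕ→ℚ a ℚ.< ℕ→ℚ b
ℕ→ℚ-mono-< {a} {b} a<b = ℚₚ.toℚᵘ-cancel-< (ℚᵘₚ.<-respˡ-≃ (ℚᵘₚ.≃-sym (ℚₚ.toℚᵘ-fromℚᵘ (mkℚᵘ (ℤ.+ a) 0)))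
  (ℚᵘₚ.<-respʳ-≃ (ℚᵘₚ.≃-sym (ℚₚ.toℚᵘ-fromℚᵘ (mkℚᵘ (ℤ.+ b) 0)))
    (ℚᵘ.*<* (subst₂ ℤ._<_ (sym (ℤₚ.*-identityʳ (ℤ.+ a))) (sym (ℤₚ.*-identityʳ (ℤ.+ b))) (ℤ.+<+ a<b)))))

ℕ→ℚ-cancel-< : ∀ {a b} → ℕ→ℚ a ℚ.< ℕ→ℚ b → a ℕ.< b
ℕ→ℚ-cancel-< {a} {b} h = ℕₚ.≰⇒> λ b≤a → case (ℕₚ.m≤n⇒m<n∨m≡n b≤a)
  where
  case : b ℕ.< a ⊎ b ≡ a → ⊥
  case (inj₁ b<a) = ℚₚ.<-asym h (ℕ→ℚ-mono-< b<a)
  case (inj₂ b≡a) = ℚₚ.<-irrefl (cong ℕ→ℚ (sym b≡a)) h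

-- Legendre's formula for the partial sums

module PartialSums {p : ℕ} (prime-p : Prime p) where
  open Digits prime-p

  -- An exhausted derivation yields the digit 0, so any number of digits can be split off.
  uncons : ∀ {n s} → DigitSum n s → ∃ λ d → ∃ λ q → ∃ λ t →
      d ℕ.< p × n ≡ d ℕ.+ q ℕ.* p × s ≡ d ℕ.+ t × DigitSum q t
  uncons [] = 0 , 0 , 0 , ℕ.>-nonZero⁻¹ p , refl , refl , []
  uncons (digit d d<p ds) = d , _ , _ , d<p , refl , refl , ds

  fracSum-step : ∀ N m q → m ℕ.< p ^ suc N →
    fracSum (m ℕ.+ q ℕ.* p ^ suc N) p (suc N) * ℕ→ℚ (p ^ suc N)
      ≡ fracSum (m ℕ.+ q ℕ.* p ^ suc N) p N * ℕ→ℚ (p ^ suc N) + ℕ→ℚ m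
  fracSum-step N m q m<P with p ^ suc N ℕ.≟ 0
  ... | yes e = ⊥-elim (ℕ.≢-nonZero⁻¹ (p ^ suc N) {{ℕₚ.m^n≢0 p (suc N)}} e)
  ... | no ne = trans (ℚₚ.*-distribʳ-+ (ℕ→ℚ (p ^ suc N)) (fracSum n p N)
      (frac (_/_ (ℤ.+ n) (p ^ suc N) {{ℕ.≢-nonZero ne}})))
      (cong (fracSum n p N * ℕ→ℚ (p ^ suc N) +_) (frac-/ m q (p ^ suc N) {{ℕ.≢-nonZero ne}} m<P))
    where n = m ℕ.+ q ℕ.* p ^ suc N

  -- With low = n mod p^N and σ the sum of the N lowest digits of n, the partial sum G / p^N satisfies
  -- (p − 1) G + low = p^N σ.
  record Partial (n s N : ℕ) : Set where
    field
      G low high σ t : ℕ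
      sum-eq : fracSum n p N * ℕ→ℚ (p ^ N) ≡ ℕ→ℚ G
      n-eq : n ≡ low ℕ.+ high ℕ.* p ^ N
      low< : low ℕ.< p ^ N
      high-digits : DigitSum high t
      s-eq : s ≡ σ ℕ.+ t
      legendre : r ℕ.* G ℕ.+ low ≡ p ^ N ℕ.* σ

  partial : ∀ {n s} → DigitSum n s → ∀ N → Partial n s N
  partial {n} {s} ds zero = record
    { G = 0 ; low = 0 ; high = n ; σ = 0 ; t = s
    ; sum-eq = refl ; n-eq = sym (ℕₚ.*-identityʳ n) ; low< = s≤s z≤n ; high-digits = ds ; s-eq = refl
    ; legendre = trans (ℕₚ.+-identityʳ (r ℕ.* 0)) (ℕₚ.*-zeroʳ r) }
  partial {n} {s} ds (suc N) = step (uncons high-digits)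
    where
    open Partial (partial ds N)
    P = p ^ N
    step : (∃ λ d → ∃ λ q → ∃ λ u → d ℕ.< p × high ≡ d ℕ.+ q ℕ.* p × t ≡ d ℕ.+ u × DigitSum q u) →
      Partial n s (suc N)
    step (d , q , u , d<p , high≡ , t≡ , du) = record
      { G = G′ ; low = low′ ; high = q ; σ = σ ℕ.+ d ; t = u
      ; sum-eq = sum-eq′ ; n-eq = n-eq′ ; low< = low′<
      ; high-digits = du ; s-eq = trans s-eq (trans (cong (σ ℕ.+_) t≡) (sym (ℕₚ.+-assoc σ d u)))
      ; legendre = legendre′ }
      where
      low′ = low ℕ.+ d ℕ.* P
      -- The common denominator grows from p^N to p^{N+1}, and the new term {n/p^{N+1}} has
      -- numerator low′.
      G′ = p ℕ.* G ℕ.+ low′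
      open ℕ-Solver using () renaming (solve to ℕ-solve; _:+_ to _⊕_; _:*_ to _⊗_; _:=_ to _⊜_; con to c)
      n-eq′ : n ≡ low′ ℕ.+ q ℕ.* p ^ suc N
      n-eq′ = trans n-eq (trans (cong (λ h → low ℕ.+ h ℕ.* P) high≡)
        (ℕ-solve 5 (λ l d q p P → l ⊕ (d ⊕ q ⊗ p) ⊗ P ⊜ (l ⊕ d ⊗ P) ⊕ q ⊗ (p ⊗ P)) refl low d q p P))
      low′< : low′ ℕ.< p ^ suc N
      low′< = ℕₚ.<-≤-trans (ℕₚ.+-monoˡ-< (d ℕ.* P) low<) (ℕₚ.*-monoˡ-≤ P d<p)
      sum-eq′ : fracSum n p (suc N) * ℕ→ℚ (p ^ suc N) ≡ ℕ→ℚ G′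
      sum-eq′ = begin
        fracSum n p (suc N) * ℕ→ℚ (p ^ suc N)
          ≡⟨ subst (λ n → fracSum n p (suc N) * ℕ→ℚ (p ^ suc N) ≡ fracSum n p N * ℕ→ℚ (p ^ suc N) + ℕ→ℚ low′)
              (sym n-eq′) (fracSum-step N low′ q low′<) ⟩
        fracSum n p N * ℕ→ℚ (p ^ suc N) + ℕ→ℚ low′ ≡⟨ cong (λ x → fracSum n p N * x + ℕ→ℚ low′) (ℕ→ℚ-* p P) ⟩
        fracSum n p N * (ℕ→ℚ p * ℕ→ℚ P) + ℕ→ℚ low′
          ≡⟨ solve 4 (λ f p P l → f :* (p :* P) :+ l := p :* (f :* P) :+ l) refl (fracSum n p N) (ℕ→ℚ p)
              (ℕ→ℚ P) (ℕ→ℚ low′) ⟩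
        ℕ→ℚ p * (fracSum n p N * ℕ→ℚ P) + ℕ→ℚ low′ ≡⟨ cong (λ x → ℕ→ℚ p * x + ℕ→ℚ low′) sum-eq ⟩
        ℕ→ℚ p * ℕ→ℚ G + ℕ→ℚ low′ ≡⟨ cong (_+ ℕ→ℚ low′) (ℕ→ℚ-* p G) ⟨
        ℕ→ℚ (p ℕ.* G) + ℕ→ℚ low′ ≡⟨ ℕ→ℚ-+ (p ℕ.* G) low′ ⟨
        ℕ→ℚ G′ ∎
        where open ≡-Reasoning
      legendre′ : r ℕ.* G′ ℕ.+ low′ ≡ p ^ suc N ℕ.* (σ ℕ.+ d)
      legendre′ = begin
        r ℕ.* (p ℕ.* G ℕ.+ low′) ℕ.+ low′
          ≡⟨ ℕ-solve 4 (λ r p G l → r ⊗ (p ⊗ G ⊕ l) ⊕ l ⊜ p ⊗ (r ⊗ G) ⊕ (c 1 ⊕ r) ⊗ l) refl r p G low′ ⟩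
        p ℕ.* (r ℕ.* G) ℕ.+ suc r ℕ.* low′ ≡⟨ cong (λ x → p ℕ.* (r ℕ.* G) ℕ.+ x ℕ.* low′) 1+r≡p ⟩
        p ℕ.* (r ℕ.* G) ℕ.+ p ℕ.* (low ℕ.+ d ℕ.* P)
          ≡⟨ ℕ-solve 5 (λ p x l d P → p ⊗ x ⊕ p ⊗ (l ⊕ d ⊗ P) ⊜ p ⊗ ((x ⊕ l) ⊕ d ⊗ P)) refl p
              (r ℕ.* G) low d P ⟩
        p ℕ.* ((r ℕ.* G ℕ.+ low) ℕ.+ d ℕ.* P) ≡⟨ cong (λ x → p ℕ.* (x ℕ.+ d ℕ.* P)) legendre ⟩
        p ℕ.* (P ℕ.* σ ℕ.+ d ℕ.* P)
          ≡⟨ ℕ-solve 4 (λ p P s d → p ⊗ (P ⊗ s ⊕ d ⊗ P) ⊜ (p ⊗ P) ⊗ (s ⊕ d)) refl p P σ d ⟩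
        p ^ suc N ℕ.* (σ ℕ.+ d) ∎
        where open ≡-Reasoning

  ℕ→ℚ-positive : ∀ k .{{_ : ℕ.NonZero k}} → ℚ.Positive (ℕ→ℚ k)
  ℕ→ℚ-positive k = ℚ.positive (ℕ→ℚ-mono-< (ℕ.>-nonZero⁻¹ k))

  n<p^n : ∀ n → n ℕ.< p ^ n
  n<p^n zero = s≤s z≤n
  n<p^n (suc n) = subst (suc n ℕ.<_) (ℕₚ.*-comm (p ^ n) p)
    (ℕₚ.<-≤-trans (s≤s (n<p^n n)) (ℕₚ.m<m*n (p ^ n) p {{ℕₚ.m^n≢0 p n}} 1<p))

  -- If s ≤ p - 1, then (p - 1) G ≤ p^N σ ≤ p^N (p - 1), so no partial sum exceeds 1.
  series>1⇒p≤s : ∀ {n s} → DigitSum n s → FracSeriesGt1 n p → p ℕ.≤ s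
  series>1⇒p≤s {n} {s} ds (N , 1<F) = ℕₚ.≮⇒≥ λ s<p → ℕₚ.<⇒≱ P<G (G≤P s<p)
    where
    open Partial (partial ds N)
    instance
      P-positive : ℚ.Positive (ℕ→ℚ (p ^ N))
      P-positive = ℕ→ℚ-positive (p ^ N) {{ℕₚ.m^n≢0 p N}}
    P<G : p ^ N ℕ.< G
    P<G = ℕ→ℚ-cancel-< (subst₂ ℚ._<_ (ℚₚ.*-identityˡ (ℕ→ℚ (p ^ N))) sum-eq
        (ℚₚ.*-monoˡ-<-pos (ℕ→ℚ (p ^ N)) 1<F))
    G≤P : s ℕ.< p → G ℕ.≤ p ^ N
    G≤P s<p = ℕₚ.*-cancelˡ-≤ r {{ℕ.>-nonZero 0<r}} (begin
      r ℕ.* G ≤⟨ ℕₚ.m≤m+n (r ℕ.* G) low ⟩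
      r ℕ.* G ℕ.+ low ≡⟨ legendre ⟩
      p ^ N ℕ.* σ
        ≤⟨ ℕₚ.*-monoʳ-≤ (p ^ N) (ℕₚ.≤-trans (subst (σ ℕ.≤_) (sym s-eq) (ℕₚ.m≤m+n σ t))
            (ℕₚ.≤-pred (subst (s ℕ.<_) (sym 1+r≡p) s<p))) ⟩
      p ^ N ℕ.* r ≡⟨ ℕₚ.*-comm (p ^ N) r ⟩
      r ℕ.* p ^ N ∎)
      where open ℕₚ.≤-Reasoning

  -- N = n terms suffice: n < p^n, so all nonzero digits are used and σ = s. Truncation loses
  -- low/((p - 1) p^n) < 1/(p - 1), less than the excess of s/(p - 1) over 1.
  p≤s⇒series>1 : ∀ {n s} → DigitSum n s → p ℕ.≤ s → FracSeriesGt1 n p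
  p≤s⇒series>1 {n} {s} ds p≤s = n , ℚₚ.*-cancelʳ-<-nonNeg
      (ℕ→ℚ P) {{ℚₚ.pos⇒nonNeg (ℕ→ℚ P) {{ℕ→ℚ-positive P {{ℕₚ.m^n≢0 p n}}}}}}
      (subst₂ ℚ._<_ (sym (ℚₚ.*-identityˡ (ℕ→ℚ P))) (sym sum-eq) (ℕ→ℚ-mono-< P<G))
    where
    open Partial (partial ds n)
    P = p ^ n
    high≡0 : high ≡ 0
    high≡0 = case high refl
      where
      case : ∀ h → high ≡ h → high ≡ 0
      case zero e = e
      case (suc h) e = ⊥-elim
          (ℕₚ.<⇒≱ (n<p^n n) (subst (P ℕ.≤_) (sym (trans n-eq (cong (λ x → low ℕ.+ x ℕ.* P) e)))
        (ℕₚ.≤-trans (ℕₚ.m≤m+n P (h ℕ.* P)) (ℕₚ.m≤n+m (P ℕ.+ h ℕ.* P) low))))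
    σ≡s : σ ≡ s
    σ≡s = sym (trans s-eq (trans (cong (σ ℕ.+_) (digitSum-zero high-digits high≡0)) (ℕₚ.+-identityʳ σ)))
    P<G : P ℕ.< G
    P<G = ℕₚ.*-cancelˡ-< r P G (ℕₚ.+-cancelʳ-< low (r ℕ.* P) (r ℕ.* G) (begin-strict
      r ℕ.* P ℕ.+ low <⟨ ℕₚ.+-monoʳ-< (r ℕ.* P) low< ⟩
      r ℕ.* P ℕ.+ P ≡⟨ trans (ℕₚ.+-comm (r ℕ.* P) P) (trans (cong (ℕ._* P) 1+r≡p) (ℕₚ.*-comm p P)) ⟩
      P ℕ.* p ≤⟨ ℕₚ.*-monoʳ-≤ P (subst (p ℕ.≤_) (sym σ≡s) p≤s) ⟩
      P ℕ.* σ ≡⟨ legendre ⟨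
      r ℕ.* G ℕ.+ low ∎))
      where open ℕₚ.≤-Reasoning

-- The denominator

primeDivisor : ∀ m .{{_ : ℕ.NonZero m}} → m ≡ 1 ⊎ ∃ λ p → Prime p × p ∣ m
primeDivisor m with factorise m
... | record { factors = [] ; isFactorisation = eq } = inj₁ eq
... | record { factors = q ∷ qs ; isFactorisation = eq ; factorsPrime = prime-q ∷ _ } =
  inj₂ (q , prime-q , subst (q ∣_) (sym eq) (m∣m*n _))

reduced : ℕ → Poly
reduced n = subConst (bernPoly n) (B n)

reduced-zero : ∀ n → reduced n 0 ≡ 0ℚ
reduced-zero n = trans (cong (λ c → ℕ→ℚ c * B n - B n) (nCn≡1 n))
    (solve 1 (λ b → con 1ℚ :* b :- b := con 0ℚ) refl (B n))

reduced-coefficient : ∀ n i k → n ≡ suc i ℕ.+ k → reduced n (suc i) ≡ ℕ→ℚ (n C k) * B k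
reduced-coefficient n i k eq with suc i ℕ.≤? n
... | yes _ = cong (λ j → ℕ→ℚ (n C j) * B j) (trans (cong (_∸ suc i) eq) (ℕₚ.m+n∸m≡n (suc i) k))
... | no i≮n = ⊥-elim (i≮n (subst (suc i ≤_) (sym eq) (ℕₚ.m≤m+n (suc i) k)))

reduced-elim : ∀ {ℓ} (P : ℚ → Set ℓ) n → P 0ℚ → (∀ k → k ℕ.< n → P (ℕ→ℚ (n C k) * B k)) →
  ∀ i → P (reduced n i)
reduced-elim P n P0 PC zero = subst P (sym (reduced-zero n)) P0
reduced-elim P n P0 PC (suc i) with suc i ℕ.≤? n
... | yes i<n = PC (n ∸ suc i) (ℕₚ.∸-monoʳ-< (s≤s z≤n) i<n)
... | no _ = P0

module AtPrime {p : ℕ} (prime-p : Prime p) where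
  open Digits prime-p
  open Localisation prime-p
  open VonStaudt prime-p
  open PartialSums prime-p

  integral-p*reduced : ∀ n i → Integral (ℕ→ℚ p * reduced n i)
  integral-p*reduced n = reduced-elim (λ x → Integral (ℕ→ℚ p * x)) n
      (integral-* (integral-ℕ p) (integral-ℕ 0))
    λ k _ → subst Integral (solve 3 (λ c p b → c :* (p :* b) := p :* (c :* b)) refl (ℕ→ℚ (n C k)) (ℕ→ℚ p)
        (B k))
      (integral-* (integral-ℕ (n C k)) (integral-pB k))

  integral-coefficient : ∀ {n s} → DigitSum n s → s ℕ.< p → ∀ k → 0 ℕ.< k → k ℕ.< n →
    Integral (ℕ→ℚ (n C k) * B k)
  integral-coefficient {n} ds s<p k 0<k k<n with r ∣? k
  ... | yes r∣k = divisible-p*⁻¹ (subst Divisible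
      (solve 3 (λ c p b → c :* (p :* b) := p :* (c :* b)) refl (ℕ→ℚ (n C k)) (ℕ→ℚ p) (B k))
      (divisible-*ʳ (divisible-ℕ (C-divisible ds s<p k 0<k k<n r∣k)) (integral-pB k)))
  ... | no r∤k = integral-* (integral-ℕ (n C k)) (integral-B k 3≤p r∤k)
    where
    3≤p : 3 ℕ.≤ p
    -- For p = 2 the number r = 1 would divide k.
    3≤p = subst (3 ℕ.≤_) 1+r≡p (s≤s (ℕₚ.≤∧≢⇒< 0<r λ 1≡r → r∤k (subst (_∣ k) 1≡r (1∣ k))))

  integral-reduced : ∀ {n s} → DigitSum n s → s ℕ.< p → ∀ i → Integral (reduced n i)
  integral-reduced {n} ds s<p = reduced-elim Integral n (integral-ℕ 0) coefficient
    where
    coefficient : ∀ k → k ℕ.< n → Integral (ℕ→ℚ (n C k) * B k)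
    -- The leading coefficient 1 stands apart: k = 0 has digit sum 0, which escapes the argument on
    -- multiples of p - 1.
    coefficient zero _ = integral-* (integral-ℕ (n C 0)) (integral-ℕ 1)
    coefficient (suc k) = integral-coefficient ds s<p (suc k) (s≤s z≤n)

  denom-minimal : ∀ f d′ → IsDenom f (p ℕ.* d′) → ¬ (∀ i → Integral (ℕ→ℚ d′ * f i))
  denom-minimal f d′ (0<d , clears , minimal) integral =
      ℕₚ.<⇒≱ (subst (d′ ℕ.<_) (ℕₚ.*-comm d′ p) (ℕₚ.m<m*n d′ p {{ℕ.>-nonZero 0<d′}} 1<p))
          (minimal d′ 0<d′ clears′)
    where
    0<d′ : 0 ℕ.< d′
    0<d′ = ℕₚ.n≢0⇒n>0 λ d′≡0 → ℕₚ.<⇒≢ 0<d (sym (trans (cong (p ℕ.*_) d′≡0) (ℕₚ.*-zeroʳ p)))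
    clears′ : Clears d′ f
    clears′ i = integral-int (integral i)
      (subst IsInt (trans (cong (_* f i) (ℕ→ℚ-* p d′)) (ℚₚ.*-assoc (ℕ→ℚ p) (ℕ→ℚ d′) (f i))) (clears i))

  p∣denom⇒series>1 : ∀ n d → IsDenom (reduced n) d → p ∣ d → FracSeriesGt1 n p
  p∣denom⇒series>1 n d isDenom (divides d′ d≡) with digitSum n
  ... | s , ds with p ℕ.≤? s
  ...   | yes p≤s = p≤s⇒series>1 ds p≤s
  ...   | no p≰s = ⊥-elim (denom-minimal (reduced n) d′
      (subst (IsDenom (reduced n)) (trans d≡ (ℕₚ.*-comm d′ p)) isDenom)
      λ i → integral-* (integral-ℕ d′) (integral-reduced ds (ℕₚ.≰⇒> p≰s) i))

  clears⇒integral : ∀ n d → Clears d (reduced n) → ¬ p ∣ d → ∀ k → k ℕ.< n → Integral (ℕ→ℚ (n C k) * B k)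
  clears⇒integral n d clears p∤d k k<n = subst Integral (reduced-coefficient n i k n≡) integral
    where
    i = n ∸ suc k
    n≡ : n ≡ suc i ℕ.+ k
    n≡ = sym (trans (sym (ℕₚ.+-suc i k)) (ℕₚ.m∸n+n≡m k<n))
    integral : Integral (reduced n (suc i))
    integral = d , p∤d , clears (suc i)

  nondivisible⇒p∣denom : ∀ n d → Clears d (reduced n) →
    (∃ λ k → 0 ℕ.< k × k ℕ.< n × r ∣ k × ¬ p ∣ n C k × Regular k) → p ∣ d
  nondivisible⇒p∣denom n d clears (k , 0<k , k<n , r∣k , p∤C , regular) =
    decidable-stable (p ∣? d) λ p∤d → nonintegral-B k (n C k) regular 0<k r∣k p∤C
        (clears⇒integral n d clears p∤d k k<n)

  series>1⇒p∣denom : ∀ n d → IsDenom (reduced n) d → FracSeriesGt1 n p → p ∣ d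
  series>1⇒p∣denom n d (_ , clears , _) series>1 =
    nondivisible⇒p∣denom n d clears (C-nondivisible ds (series>1⇒p≤s ds series>1))
    where ds = proj₂ (digitSum n)

  -- A single factor p already makes every coefficient p-integral, so of two such factors one could
  -- be dropped.
  p²∤denom : ∀ n d → IsDenom (reduced n) d → ¬ p ℕ.* p ∣ d
  p²∤denom n d isDenom (divides q d≡) = denom-minimal (reduced n) (q ℕ.* p)
    (subst (IsDenom (reduced n)) (trans d≡ (trans (sym (ℕₚ.*-assoc q p p)) (ℕₚ.*-comm (q ℕ.* p) p))) isDenom)
    λ i → subst Integral (trans (sym (ℚₚ.*-assoc (ℕ→ℚ q) (ℕ→ℚ p) (reduced n i)))
        (cong (_* reduced n i) (sym (ℕ→ℚ-* q p))))
      (integral-* (integral-ℕ q) (integral-p*reduced n i))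

squareFree-denom : ∀ n d → IsDenom (reduced n) d → SquareFree d
squareFree-denom n d (0<d , _) zero (divides q d≡) = ⊥-elim (ℕₚ.<⇒≢ 0<d (sym (trans d≡ (ℕₚ.*-zeroʳ q))))
squareFree-denom n d isDenom m@(suc _) m²∣d with primeDivisor m
... | inj₁ m≡1 = m≡1
... | inj₂ (p , prime-p , p∣m) = ⊥-elim (AtPrime.p²∤denom prime-p n d isDenom
    (∣-trans (*-pres-∣ p∣m p∣m) m²∣d))

theorem2 : (n : ℕ) → 1 ≤ n → (d : ℕ) → IsDenom (subConst (bernPoly n) (B n)) d →
    ((p : ℕ) → Prime p → (FracSeriesGt1 n p ⇔ p ∣ d)) × SquareFree d
theorem2 n _ d isDenom =
  (λ p prime-p → mk⇔ (AtPrime.series>1⇒p∣denom prime-p n d isDenom)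
      (AtPrime.p∣denom⇒series>1 prime-p n d isDenom)) ,
  squareFree-denom n d isDenom
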